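{- Let $D^-$ be the additive code defined in the context and let $D^{3- }$ be any code of length $9$ obtained from $D^-$ by puncturing any two of its coordinates. Then the coset graph $\Gamma_{D^{3- }}$ is strongly regular with parameters $(64,27,10,12)$, and its spectrum is $\{27^1,3^{36},(-5)^{27}\}$ (exponents are multiplicities).
   Context: $\mathbb{F}_4=\{0,1,\omega,\omega^2\}$ with $\omega^2=\omega+1$. Puncturing means projecting onto the remaining coordinates. The coset graph $\Gamma_C$ of an additive code $C\subseteq\mathbb{F}_4^n$ (additive subgroup) has as vertices the cosets $x+C$, two cosets adjacent if their difference contains a vector of Hamming weight $1$. Strongly regular parameters $(\nu,\kappa,\lambda,\mu)$: vertices, degree, common neighbours of adjacent pairs, of non-adjacent pairs. $D^-$ is the $\mathbb{F}_2$-span of the following $12$ vectors of $\mathbb{F}_4^{11}$: $(0,0,0,0,0,\omega^2,\omega^2,0,\omega,1,\omega)$, $(0,0,0,0,0,\omega,0,\omega,\omega,\omega,1)$, $(1,0,0,0,0,1,0,1,\omega^2,\omega^2,1)$, $(\omega,0,0,0,0,0,\omega,1,\omega,\omega,\omega)$, $(0,1,0,0,0,0,1,1,1,\omega^2,\omega^2)$, $(0,\omega,0,0,0,\omega^2,1,\omega^2,\omega,\omega,0)$, $(0,0,1,0,0,\omega,\omega,1,1,0,1)$, $(0,0,\omega,0,0,\omega,1,\omega,\omega^2,\omega^2,0)$, $(0,0,0,1,0,\omega,\omega,\omega,0,1,\omega)$, $(0,0,0,\omega,0,\omega^2,1,1,\omega^2,0,\omega)$, $(0,0,0,0,1,\omega^2,\omega^2,\omega^2,1,0,\omega^2)$,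 $(0,0,0,0,\omega,\omega,1,0,1,\omega,\omega)$. -}

module Defs where

open import Data.Bool using (Bool; true; false; if_then_else_)
open import Data.Nat using (ℕ; zero; suc)
import Data.Nat as ℕ
open import Data.Integer using (ℤ; +_)
open import Data.Fin using (Fin; zero; suc; punchOut)
open import Data.Vec using (Vec; []; _∷_; zipWith; replicate; removeAt)
open import Data.List using (List; []; _∷_; length; filter; allFin)
import Data.List as List
open import Data.List.Relation.Unary.All using (All)
open import Data.Nat.ListAction using (sum)
import Data.Vec.Properties as VecP
import Data.Nat.Properties as ℕP
open import Data.Product using (Σ; ∃; _×_; _,_; proj₁; proj₂)
open import Data.Sum using (_⊎_; inj₁; inj₂)
open import Data.Empty using (⊥)
open import Relation.Nullary using (¬_; Dec; yes; no; does)
open import Relation.Nullary.Decidable using (map′)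
open import Relation.Binary.PropositionalEquality using (_≡_; _≢_; refl; cong; cong₂)
open import Relation.Unary using (Pred; Decidable)
open import Data.Rational using (ℚ; 0ℚ; 1ℚ; _+_; _*_; _/_; -_)

_×?_ : ∀ {A B : Set} → Dec A → Dec B → Dec (A × B)
yes a ×? yes b = yes (a , b)
yes a ×? no ¬b = no (λ p → ¬b (proj₂ p))
no ¬a ×? _     = no (λ p → ¬a (proj₁ p))

data F4 : Set where
  𝟎 𝟏 ω ω² : F4

infixl 6 _⊹_
_⊹_ : F4 → F4 → F4
𝟎  ⊹ y  = y
x  ⊹ 𝟎  = x
𝟏  ⊹ 𝟏  = 𝟎
𝟏  ⊹ ω  = ω²
𝟏  ⊹ ω² = ω
ω  ⊹ 𝟏  = ω²
ω  ⊹ ω  = 𝟎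
ω  ⊹ ω² = 𝟏
ω² ⊹ 𝟏  = ω
ω² ⊹ ω  = 𝟏
ω² ⊹ ω² = 𝟎

-- additive inverse in F4 (characteristic 2, so it is the identity)
⊝_ : F4 → F4
⊝ x = x

Word : ℕ → Set
Word n = Vec F4 n

_⊕_ : ∀ {n} → Word n → Word n → Word n
_⊕_ = zipWith _⊹_

_⊖_ : ∀ {n} → Word n → Word n → Word n
x ⊖ y = zipWith (λ a b → a ⊹ (⊝ b)) x y

weight : ∀ {n} → Word n → ℕ
weight []        = 0
weight (𝟎 ∷ xs)  = weight xs
weight (_ ∷ xs)  = suc (weight xs)

generators : Vec (Word 11) 12
generators =
    (𝟎 ∷ 𝟎 ∷ 𝟎 ∷ 𝟎 ∷ 𝟎 ∷ ω² ∷ ω² ∷ 𝟎 ∷ ω ∷ 𝟏 ∷ ω ∷ [])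
  ∷ (𝟎 ∷ 𝟎 ∷ 𝟎 ∷ 𝟎 ∷ 𝟎 ∷ ω ∷ 𝟎 ∷ ω ∷ ω ∷ ω ∷ 𝟏 ∷ [])
  ∷ (𝟏 ∷ 𝟎 ∷ 𝟎 ∷ 𝟎 ∷ 𝟎 ∷ 𝟏 ∷ 𝟎 ∷ 𝟏 ∷ ω² ∷ ω² ∷ 𝟏 ∷ [])
  ∷ (ω ∷ 𝟎 ∷ 𝟎 ∷ 𝟎 ∷ 𝟎 ∷ 𝟎 ∷ ω ∷ 𝟏 ∷ ω ∷ ω ∷ ω ∷ [])
  ∷ (𝟎 ∷ 𝟏 ∷ 𝟎 ∷ 𝟎 ∷ 𝟎 ∷ 𝟎 ∷ 𝟏 ∷ 𝟏 ∷ 𝟏 ∷ ω² ∷ ω² ∷ [])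
  ∷ (𝟎 ∷ ω ∷ 𝟎 ∷ 𝟎 ∷ 𝟎 ∷ ω² ∷ 𝟏 ∷ ω² ∷ ω ∷ ω ∷ 𝟎 ∷ [])
  ∷ (𝟎 ∷ 𝟎 ∷ 𝟏 ∷ 𝟎 ∷ 𝟎 ∷ ω ∷ ω ∷ 𝟏 ∷ 𝟏 ∷ 𝟎 ∷ 𝟏 ∷ [])
  ∷ (𝟎 ∷ 𝟎 ∷ ω ∷ 𝟎 ∷ 𝟎 ∷ ω ∷ 𝟏 ∷ ω ∷ ω² ∷ ω² ∷ 𝟎 ∷ [])
  ∷ (𝟎 ∷ 𝟎 ∷ 𝟎 ∷ 𝟏 ∷ 𝟎 ∷ ω ∷ ω ∷ ω ∷ 𝟎 ∷ 𝟏 ∷ ω ∷ [])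
  ∷ (𝟎 ∷ 𝟎 ∷ 𝟎 ∷ ω ∷ 𝟎 ∷ ω² ∷ 𝟏 ∷ 𝟏 ∷ ω² ∷ 𝟎 ∷ ω ∷ [])
  ∷ (𝟎 ∷ 𝟎 ∷ 𝟎 ∷ 𝟎 ∷ 𝟏 ∷ ω² ∷ ω² ∷ ω² ∷ 𝟏 ∷ 𝟎 ∷ ω² ∷ [])
  ∷ (𝟎 ∷ 𝟎 ∷ 𝟎 ∷ 𝟎 ∷ ω ∷ ω ∷ 𝟏 ∷ 𝟎 ∷ 𝟏 ∷ ω ∷ ω ∷ [])
  ∷ []

combination : ∀ {m n} → Vec Bool m → Vec (Word n) m → Word n
combination []           []       = replicate _ 𝟎
combination (true  ∷ cs) (g ∷ gs) = g ⊕ combination cs gs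
combination (false ∷ cs) (g ∷ gs) = combination cs gs

D⁻ : Pred (Word 11) _
D⁻ x = Σ (Vec Bool 12) λ c → combination c generators ≡ x

-- Puncturing D⁻ at two distinct coordinates i ≢ j
-- (delete coordinate i, then delete the coordinate that was j)

puncture : (i j : Fin 11) → i ≢ j → Word 11 → Word 9
puncture i j i≢j x = removeAt (removeAt x i) (punchOut i≢j)

D³⁻ : (i j : Fin 11) → i ≢ j → Pred (Word 9) _
D³⁻ i j i≢j y = Σ (Word 11) λ x → D⁻ x × puncture i j i≢j x ≡ y

-- Coset graph of an additive code C ⊆ F4^n.
-- Vertices are cosets x + C, represented by words; two words lie in the
-- same coset iff their difference is in C; cosets x + C, y + C are adjacent
-- iff (x + C) - (y + C) = (x - y) + C contains a word of Hamming weight 1.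

module CosetGraph {n : ℕ} (C : Pred (Word n) Agda.Primitive.lzero) where

  SameCoset : Word n → Word n → Set
  SameCoset x y = C (x ⊖ y)

  Adjacent : Word n → Word n → Set
  Adjacent x y = Σ (Word n) λ w → weight w ≡ 1 × C ((x ⊖ y) ⊖ w)

  IsTransversal : ∀ {ν} → (Fin ν → Word n) → Set
  IsTransversal {ν} R =
    (∀ i j → SameCoset (R i) (R j) → i ≡ j) × (∀ x → Σ (Fin ν) λ i → SameCoset x (R i))

_≟F4_ : (a b : F4) → Dec (a ≡ b)
𝟎  ≟F4 𝟎  = yes refl
𝟏  ≟F4 𝟏  = yes refl
ω  ≟F4 ω  = yes refl
ω² ≟F4 ω² = yes refl
𝟎  ≟F4 𝟏  = no λ ()
𝟎  ≟F4 ω  = no λ ()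
𝟎  ≟F4 ω² = no λ ()
𝟏  ≟F4 𝟎  = no λ ()
𝟏  ≟F4 ω  = no λ ()
𝟏  ≟F4 ω² = no λ ()
ω  ≟F4 𝟎  = no λ ()
ω  ≟F4 𝟏  = no λ ()
ω  ≟F4 ω² = no λ ()
ω² ≟F4 𝟎  = no λ ()
ω² ≟F4 𝟏  = no λ ()
ω² ≟F4 ω  = no λ ()

_≟W_ : ∀ {n} (x y : Word n) → Dec (x ≡ y)
_≟W_ = VecP.≡-dec _≟F4_

∃Bool? : {P : Bool → Set} → (∀ b → Dec (P b)) → Dec (Σ Bool P)
∃Bool? P? with P? true | P? false
... | yes p | _     = yes (true , p)
... | no _  | yes q = yes (false , q)
... | no ¬p | no ¬q = no λ { (true , p) → ¬p p ; (false , q) → ¬q q }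

∃F4? : {P : F4 → Set} → (∀ a → Dec (P a)) → Dec (Σ F4 P)
∃F4? P? with P? 𝟎 | P? 𝟏 | P? ω | P? ω²
... | yes p | _ | _ | _ = yes (𝟎 , p)
... | no _ | yes p | _ | _ = yes (𝟏 , p)
... | no _ | no _ | yes p | _ = yes (ω , p)
... | no _ | no _ | no _ | yes p = yes (ω² , p)
... | no a | no b | no c | no d =
  no λ { (𝟎 , p) → a p ; (𝟏 , p) → b p ; (ω , p) → c p ; (ω² , p) → d p }

∃Vec? : ∀ {A : Set} →
        (∀ {P : A → Set} → (∀ a → Dec (P a)) → Dec (Σ A P)) →
        ∀ n {P : Vec A n → Set} → (∀ v → Dec (P v)) → Dec (Σ (Vec A n) P)
∃Vec? ∃A? zero    P? with P? []
... | yes p = yes ([] , p)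
... | no ¬p = no λ { ([] , p) → ¬p p }
∃Vec? ∃A? (suc n) {P} P? with ∃A? (λ a → ∃Vec? ∃A? n (λ v → P? (a ∷ v)))
... | yes (a , v , p) = yes (a ∷ v , p)
... | no ¬p = no λ { (a ∷ v , p) → ¬p (a , v , p) }

D⁻? : ∀ x → Dec (D⁻ x)
D⁻? x = ∃Vec? ∃Bool? 12 (λ c → combination c generators ≟W x)

D³⁻? : ∀ i j (i≢j : i ≢ j) y → Dec (D³⁻ i j i≢j y)
D³⁻? i j i≢j y = ∃Vec? ∃F4? 11 (λ x → D⁻? x ×? (puncture i j i≢j x ≟W y))

Adjacent? : ∀ i j (i≢j : i ≢ j) (x y : Word 9) → Dec (CosetGraph.Adjacent (D³⁻ i j i≢j) x y)
Adjacent? i j i≢j x y =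
  ∃Vec? ∃F4? 9 (λ w → (weight w ℕP.≟ 1) ×? D³⁻? i j i≢j ((x ⊖ y) ⊖ w))

Rel₂ : ℕ → Set₁
Rel₂ ν = Fin ν → Fin ν → Set

Decidable₂ : ∀ {ν} → Rel₂ ν → Set
Decidable₂ {ν} E = ∀ i j → Dec (E i j)

count : ∀ {ν} {P : Pred (Fin ν) Agda.Primitive.lzero} → Decidable P → ℕ
count {ν} P? = length (filter P? (allFin ν))


IsSRG : (ν κ λ' μ : ℕ) (E : Rel₂ ν) → Decidable₂ E → Set
IsSRG ν κ λ' μ E E? =
    (∀ i → ¬ E i i)
  × (∀ i j → E i j → E j i)
  × (∀ i → count (E? i) ≡ κ)
  × (∀ i j → E i j →
       count (λ k → E? i k ×? E? j k) ≡ λ')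
  × (∀ i j → i ≢ j → ¬ E i j →
       count (λ k → E? i k ×? E? j k) ≡ μ)

sumℚ : ∀ {m} → (Fin m → ℚ) → ℚ
sumℚ {zero}  f = 0ℚ
sumℚ {suc m} f = f zero + sumℚ (λ k → f (suc k))

adjMatrix : ∀ {ν} {E : Rel₂ ν} → Decidable₂ E → Fin ν → Fin ν → ℚ
adjMatrix E? i j = if does (E? i j) then 1ℚ else 0ℚ

_·_ : ∀ {ν} → (Fin ν → Fin ν → ℚ) → (Fin ν → ℚ) → (Fin ν → ℚ)
(A · v) i = sumℚ (λ j → A i j * v j)

IsEigenvector : ∀ {ν} → (Fin ν → Fin ν → ℚ) → ℚ → (Fin ν → ℚ) → Set
IsEigenvector A θ v = ∀ i → (A · v) i ≡ θ * v i

lincomb : ∀ {m ν} → (Fin m → ℚ) → (Fin m → Fin ν → ℚ) → Fin ν → ℚ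
lincomb c B i = sumℚ (λ k → c k * B k i)

EigenMultiplicity : ∀ {ν} → (Fin ν → Fin ν → ℚ) → ℚ → ℕ → Set
EigenMultiplicity {ν} A θ m =
  Σ (Fin m → Fin ν → ℚ) λ B →
      (∀ k → IsEigenvector A θ (B k))
    × (∀ c → (∀ i → lincomb c B i ≡ 0ℚ) → ∀ k → c k ≡ 0ℚ)
    × (∀ v → IsEigenvector A θ v → Σ (Fin m → ℚ) λ c → ∀ i → lincomb c B i ≡ v i)

-- spectrum of a (symmetric) matrix as a list of (eigenvalue, multiplicity):
-- every listed eigenvalue has the given multiplicity, and the multiplicities
-- add up to ν, so there are no further eigenvalues.
HasSpectrum : ∀ {ν} → (Fin ν → Fin ν → ℚ) → List (ℚ × ℕ) → Set
HasSpectrum {ν} A spec =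
    All (λ p → EigenMultiplicity A (proj₁ p) (proj₂ p)) spec
  × sum (List.map proj₂ spec) ≡ ν

ℤ→ℚ : ℤ → ℚ
ℤ→ℚ z = z / 1

{-# OPTIONS --safe #-}
-- A syndrome map identifies the cosets of a punctured code with F₄³, and the coset graph
-- becomes the Cayley graph of F₄³ on the set S of syndromes of the 27 words of weight one.
-- Its eigenvectors are the characters of F₄³; the character of a has eigenvalue 27 − 2c(a),
-- where c(a) counts the p ∈ S on which it is −1.  For a ≠ 0 the number c(a)/2 is the weight
-- of a nonzero word of the dual code, which is 6 or 8, so the other eigenvalues are 3 and −5.
-- Both satisfy θ² + 2θ = 15, hence A² + 2A = 15I + 12J by comparing Fourier coefficients,
-- and this gives the parameters.
-- The graphs of different pairs of coordinates are not all isomorphic, so c is computed for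
-- each pair; the syndrome maps come from seven information sets of D⁻ whose complements
-- cover all pairs.
module Submission where

open import Defs
open import Algebra.Bundles using (CommutativeRing)
import Algebra.Properties.CommutativeSemigroup
import Algebra.Properties.Group
import Algebra.Properties.Semiring.Sum
open import Data.Bool using (Bool; true; false; if_then_else_; _∧_; _xor_)
import Data.Bool.Properties as Boolₚ
open import Data.Fin using (Fin; zero; suc; _≟_; remQuot; combine; punchOut)
open import Data.Fin.Permutation using (Permutation′; permutation; _⟨$⟩ʳ_)
import Data.Fin.Properties as Finₚ
import Data.Integer as ℤ
import Data.Integer.Properties as ℤₚ
open import Data.List using (List; []; _∷_; length; map; foldr; filter; tabulate; allFin; lookup)
import Data.List.Membership.DecPropositional as DecMembership
open import Data.List.Membership.Propositional using (_∈_; _∉_)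
open import Data.List.Membership.Propositional.Properties using (∈-map⁺; ∈-map⁻; ∈-filter⁻; ∈-lookup)
open import Data.List.Properties using (filter-≐)
open import Data.List.Relation.Unary.All as All using (All; []; _∷_)
import Data.List.Relation.Unary.All.Properties as Allₚ
open import Data.List.Relation.Unary.AllPairs using ([]; _∷_)
open import Data.List.Relation.Unary.Any as Any using (Any; here; there)
open import Data.List.Relation.Unary.Unique.DecPropositional (_≟W_ {3}) using (unique?)
open import Data.List.Relation.Unary.Unique.Propositional using (Unique)
import Data.List.Relation.Unary.Unique.Propositional.Properties as Uniqueₚ
open import Data.Nat using (ℕ; zero; suc; _^_)
import Data.Nat as ℕ
import Data.Nat.Coprimality as Coprimality
import Data.Nat.Properties as ℕₚ
open import Data.Product using (Σ; ∃; _×_; _,_; proj₁; proj₂)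
open import Data.Rational as ℚ using (ℚ; 0ℚ; 1ℚ)
import Data.Rational.Properties as ℚₚ
import Data.Rational.Unnormalised as ℚᵘ
import Data.Rational.Unnormalised.Properties as ℚᵘₚ
open import Data.Sum using (_⊎_; inj₁; inj₂)
open import Data.Vec as Vec using (Vec; []; _∷_; zipWith; replicate; removeAt; concat)
import Data.Vec.Properties as Vecₚ
open import Data.Vec.Relation.Unary.All as VecAll using ([]; _∷_)
open import Function using (_∘_; _⇔_; mk⇔; Equivalence)
open import Relation.Binary.PropositionalEquality
open import Relation.Nullary using (¬_; Dec; yes; no; does; contradiction)
open import Relation.Nullary.Decidable using (_×-dec_; _⊎-dec_; ¬?; map′; toWitness; does-⇔; dec-true; dec-false)
open import Relation.Unary using (Decidable)
open ≡-Reasoning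

-- Words over F₄ and additive maps

∀F4? : {P : F4 → Set} → (∀ a → Dec (P a)) → Dec (∀ a → P a)
∀F4? P? = map′ (λ { (p , q , r , s) → λ { 𝟎 → p ; 𝟏 → q ; ω → r ; ω² → s } })
               (λ p → p 𝟎 , p 𝟏 , p ω , p ω²)
               (P? 𝟎 ×-dec P? 𝟏 ×-dec P? ω ×-dec P? ω²)

⊹-assoc : ∀ a b c → (a ⊹ b) ⊹ c ≡ a ⊹ (b ⊹ c)
⊹-assoc = toWitness {a? = ∀F4? λ a → ∀F4? λ b → ∀F4? λ c → ((a ⊹ b) ⊹ c) ≟F4 (a ⊹ (b ⊹ c))} _

⊹-comm : ∀ a b → a ⊹ b ≡ b ⊹ a
⊹-comm = toWitness {a? = ∀F4? λ a → ∀F4? λ b → (a ⊹ b) ≟F4 (b ⊹ a)} _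

⊹-self : ∀ a → a ⊹ a ≡ 𝟎
⊹-self = toWitness {a? = ∀F4? λ a → (a ⊹ a) ≟F4 𝟎} _

𝟘 : ∀ {n} → Word n
𝟘 = replicate _ 𝟎

module _ {n : ℕ} where

  ⊕-assoc : ∀ (x y z : Word n) → (x ⊕ y) ⊕ z ≡ x ⊕ (y ⊕ z)
  ⊕-assoc = Vecₚ.zipWith-assoc ⊹-assoc

  ⊕-comm : ∀ (x y : Word n) → x ⊕ y ≡ y ⊕ x
  ⊕-comm = Vecₚ.zipWith-comm ⊹-comm

  ⊕-identityˡ : ∀ (x : Word n) → 𝟘 ⊕ x ≡ x
  ⊕-identityˡ = Vecₚ.zipWith-identityˡ (λ _ → refl)

  ⊕-identityʳ : ∀ (x : Word n) → x ⊕ 𝟘 ≡ x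
  ⊕-identityʳ x = trans (⊕-comm x 𝟘) (⊕-identityˡ x)

⊕-self : ∀ {n} (x : Word n) → x ⊕ x ≡ 𝟘
⊕-self []      = refl
⊕-self (a ∷ x) = cong₂ _∷_ (⊹-self a) (⊕-self x)

module _ {n : ℕ} where

  ⊕-cancelˡ : ∀ (x y : Word n) → x ⊕ (x ⊕ y) ≡ y
  ⊕-cancelˡ x y = trans (sym (⊕-assoc x x y)) (trans (cong (_⊕ y) (⊕-self x)) (⊕-identityˡ y))

  ⊕≡𝟘⇒≡ : ∀ {x y : Word n} → x ⊕ y ≡ 𝟘 → x ≡ y
  ⊕≡𝟘⇒≡ {x} {y} eq = trans (sym (⊕-identityʳ x)) (trans (cong (x ⊕_) (sym eq)) (⊕-cancelˡ x y))

  ⊕-interchange : ∀ (x y z t : Word n) → (x ⊕ y) ⊕ (z ⊕ t) ≡ (x ⊕ z) ⊕ (y ⊕ t)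
  ⊕-interchange x y z t = begin
    (x ⊕ y) ⊕ (z ⊕ t)   ≡⟨ ⊕-assoc x y (z ⊕ t) ⟩
    x ⊕ (y ⊕ (z ⊕ t))   ≡⟨ cong (x ⊕_) (⊕-assoc y z t) ⟨
    x ⊕ ((y ⊕ z) ⊕ t)   ≡⟨ cong (λ u → x ⊕ (u ⊕ t)) (⊕-comm y z) ⟩
    x ⊕ ((z ⊕ y) ⊕ t)   ≡⟨ cong (x ⊕_) (⊕-assoc z y t) ⟩
    x ⊕ (z ⊕ (y ⊕ t))   ≡⟨ ⊕-assoc x z (y ⊕ t) ⟨
    (x ⊕ z) ⊕ (y ⊕ t)   ∎

Additive : ∀ {m n} → (Word m → Word n) → Set
Additive f = ∀ x y → f (x ⊕ y) ≡ f x ⊕ f y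

additive-𝟘 : ∀ {m n} {f : Word m → Word n} → Additive f → f 𝟘 ≡ 𝟘
additive-𝟘 {f = f} f-add = begin
  f 𝟘                   ≡⟨ ⊕-cancelˡ (f 𝟘) (f 𝟘) ⟨
  f 𝟘 ⊕ (f 𝟘 ⊕ f 𝟘)     ≡⟨ cong (f 𝟘 ⊕_) (f-add 𝟘 𝟘) ⟨
  f 𝟘 ⊕ f (𝟘 ⊕ 𝟘)       ≡⟨ cong (λ x → f 𝟘 ⊕ f x) (⊕-self 𝟘) ⟩
  f 𝟘 ⊕ f 𝟘             ≡⟨ ⊕-self (f 𝟘) ⟩
  𝟘                     ∎

∘-additive : ∀ {l m n} {f : Word m → Word n} {g : Word l → Word m} →
             Additive f → Additive g → Additive (f ∘ g)
∘-additive {f = f} f-add g-add x y = trans (cong f (g-add x y)) (f-add _ _)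

⊕-additive : ∀ {m n} {f g : Word m → Word n} → Additive f → Additive g → Additive (λ x → f x ⊕ g x)
⊕-additive f-add g-add x y = trans (cong₂ _⊕_ (f-add x y) (g-add x y)) (⊕-interchange _ _ _ _)

removeAt-additive : ∀ {n} (i : Fin (suc n)) → Additive (λ x → removeAt x i)
removeAt-additive zero (_ ∷ _) (_ ∷ _) = refl
removeAt-additive (suc i) (a ∷ x@(_ ∷ _)) (b ∷ y@(_ ∷ _)) = cong (a ⊹ b ∷_) (removeAt-additive i x y)

combination-additive : ∀ {m n} (M : Vec (Word n) m) c d →
  combination (zipWith _xor_ c d) M ≡ combination c M ⊕ combination d M
combination-additive [] [] [] = sym (⊕-self 𝟘)
combination-additive (g ∷ M) (false ∷ c) (false ∷ d) = combination-additive M c d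
combination-additive (g ∷ M) (true ∷ c) (false ∷ d) =
  trans (cong (g ⊕_) (combination-additive M c d)) (sym (⊕-assoc g _ _))
combination-additive (g ∷ M) (false ∷ c) (true ∷ d) = begin
  g ⊕ combination (zipWith _xor_ c d) M       ≡⟨ cong (g ⊕_) (combination-additive M c d) ⟩
  g ⊕ (combination c M ⊕ combination d M)     ≡⟨ ⊕-assoc g _ _ ⟨
  (g ⊕ combination c M) ⊕ combination d M     ≡⟨ cong (_⊕ combination d M) (⊕-comm g _) ⟩
  (combination c M ⊕ g) ⊕ combination d M     ≡⟨ ⊕-assoc _ g _ ⟩
  combination c M ⊕ (g ⊕ combination d M)     ∎
combination-additive (g ∷ M) (true ∷ c) (true ∷ d) = begin
  combination (zipWith _xor_ c d) M                   ≡⟨ combination-additive M c d ⟩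
  combination c M ⊕ combination d M                   ≡⟨ ⊕-identityˡ _ ⟨
  𝟘 ⊕ (combination c M ⊕ combination d M)             ≡⟨ cong (_⊕ _) (⊕-self g) ⟨
  (g ⊕ g) ⊕ (combination c M ⊕ combination d M)       ≡⟨ ⊕-interchange g g _ _ ⟩
  (g ⊕ combination c M) ⊕ (g ⊕ combination d M)       ∎

-- `bit₁` and `bit₂` are the coordinates with respect to the 𝔽₂-basis `𝟏`, `ω`.
bit₁ : F4 → Bool
bit₁ 𝟎  = false
bit₁ 𝟏  = true
bit₁ ω  = false
bit₁ ω² = true

bit₂ : F4 → Bool
bit₂ 𝟎  = false
bit₂ 𝟏  = false
bit₂ ω  = true
bit₂ ω² = true

bit₁-⊹ : ∀ a b → bit₁ (a ⊹ b) ≡ bit₁ a xor bit₁ b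
bit₁-⊹ = toWitness {a? = ∀F4? λ a → ∀F4? λ b → bit₁ (a ⊹ b) Boolₚ.≟ (bit₁ a xor bit₁ b)} _

bit₂-⊹ : ∀ a b → bit₂ (a ⊹ b) ≡ bit₂ a xor bit₂ b
bit₂-⊹ = toWitness {a? = ∀F4? λ a → ∀F4? λ b → bit₂ (a ⊹ b) Boolₚ.≟ (bit₂ a xor bit₂ b)} _

bits : ∀ {n} → Word n → Vec Bool (n ℕ.* 2)
bits []      = []
bits (a ∷ x) = bit₁ a ∷ bit₂ a ∷ bits x

bits-⊕ : ∀ {n} (x y : Word n) → bits (x ⊕ y) ≡ zipWith _xor_ (bits x) (bits y)
bits-⊕ []      []      = refl
bits-⊕ (a ∷ x) (b ∷ y) = cong₂ _∷_ (bit₁-⊹ a b) (cong₂ _∷_ (bit₂-⊹ a b) (bits-⊕ x y))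

-- The rows of M are the images of 𝟏 and ω at the successive coordinates.
lin : ∀ {m n} → Vec (Word n) (m ℕ.* 2) → Word m → Word n
lin M x = combination (bits x) M

lin-additive : ∀ {m n} (M : Vec (Word n) (m ℕ.* 2)) → Additive (lin {m} M)
lin-additive M x y = trans (cong (λ c → combination c M) (bits-⊕ x y)) (combination-additive M (bits x) (bits y))

-- The rows come in the order that `lin` reads them, so `lin (matrix f)` agrees with `f` whenever
-- `f` is additive.
matrix : ∀ {m n} → (Word m → Word n) → Vec (Word n) (m ℕ.* 2)
matrix {zero}  f = []
matrix {suc m} f = f (𝟏 ∷ 𝟘) ∷ f (ω ∷ 𝟘) ∷ matrix (λ x → f (𝟎 ∷ x))

basis : ∀ n → List (Word n)
basis zero    = []
basis (suc n) = (𝟏 ∷ 𝟘) ∷ (ω ∷ 𝟘) ∷ map (𝟎 ∷_) (basis n)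

-- `basis` is an 𝔽₂-basis, so additivity reduces an identity over all words to two checks per
-- coordinate: 18 checks for the 4⁹ words of length nine.
additive-ext : ∀ {m n} {f g : Word m → Word n} → Additive f → Additive g →
               All (λ e → f e ≡ g e) (basis m) → f ≗ g
additive-ext f-add g-add [] [] = trans (additive-𝟘 f-add) (sym (additive-𝟘 g-add))
additive-ext {suc m} {n} {f} {g} f-add g-add (f𝟏≡g𝟏 ∷ fω≡gω ∷ f≡g) (a ∷ x) = begin
  f (a ∷ x)                   ≡⟨ split f-add ⟩
  f (a ∷ 𝟘) ⊕ f (𝟎 ∷ x)       ≡⟨ cong₂ _⊕_ (first a) (additive-ext (f-add on-tail) (g-add on-tail) (Allₚ.map⁻ f≡g) x) ⟩
  g (a ∷ 𝟘) ⊕ g (𝟎 ∷ x)       ≡⟨ split g-add ⟨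
  g (a ∷ x)                   ∎
  where
  _on-tail : ∀ {h : Word (suc m) → Word n} → Additive h → Additive (λ x → h (𝟎 ∷ x))
  (h-add on-tail) x y = h-add (𝟎 ∷ x) (𝟎 ∷ y)

  split : ∀ {h : Word (suc m) → Word n} → Additive h → h (a ∷ x) ≡ h (a ∷ 𝟘) ⊕ h (𝟎 ∷ x)
  split {h} h-add = trans (cong₂ (λ b y → h (b ∷ y)) (⊹-comm 𝟎 a) (sym (⊕-identityˡ x))) (h-add (a ∷ 𝟘) (𝟎 ∷ x))

  -- The value at `ω²` is forced, because `ω²` is `𝟏 ⊹ ω`.
  double : ∀ {h : Word (suc m) → Word n} → Additive h → h (ω² ∷ 𝟘) ≡ h (𝟏 ∷ 𝟘) ⊕ h (ω ∷ 𝟘)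
  double {h} h-add = trans (cong (λ y → h (ω² ∷ y)) (sym (⊕-self 𝟘))) (h-add (𝟏 ∷ 𝟘) (ω ∷ 𝟘))

  first : ∀ a → f (a ∷ 𝟘) ≡ g (a ∷ 𝟘)
  first 𝟎  = trans (additive-𝟘 f-add) (sym (additive-𝟘 g-add))
  first 𝟏  = f𝟏≡g𝟏
  first ω  = fω≡gω
  first ω² = trans (double f-add) (trans (cong₂ _⊕_ f𝟏≡g𝟏 fω≡gω) (sym (double g-add)))

combination-kernel : ∀ {k m n} {f : Word m → Word n} → Additive f → {M : Vec (Word m) k} →
  VecAll.All (λ g → f g ≡ 𝟘) M → ∀ c → f (combination c M) ≡ 𝟘
combination-kernel f-add []          []          = additive-𝟘 f-add
combination-kernel f-add (fg≡𝟘 ∷ p) (true  ∷ c) =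
  trans (f-add _ _) (trans (cong₂ _⊕_ fg≡𝟘 (combination-kernel f-add p c)) (⊕-self 𝟘))
combination-kernel f-add (fg≡𝟘 ∷ p) (false ∷ c) = combination-kernel f-add p c

-- Words of weight one.

weightOne : ∀ n → List (Word n)
weightOne zero    = []
weightOne (suc n) = (𝟏 ∷ 𝟘) ∷ (ω ∷ 𝟘) ∷ (ω² ∷ 𝟘) ∷ map (𝟎 ∷_) (weightOne n)

weight-𝟘 : ∀ n → weight (𝟘 {n}) ≡ 0
weight-𝟘 zero    = refl
weight-𝟘 (suc n) = weight-𝟘 n

weight≡0⇒𝟘 : ∀ {n} (x : Word n) → weight x ≡ 0 → x ≡ 𝟘
weight≡0⇒𝟘 []      _  = refl
weight≡0⇒𝟘 (𝟎 ∷ x) eq = cong (𝟎 ∷_) (weight≡0⇒𝟘 x eq)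

weightOne-complete : ∀ {n} (x : Word n) → weight x ≡ 1 → x ∈ weightOne n
weightOne-complete (𝟎 ∷ x)  eq = there (there (there (∈-map⁺ (𝟎 ∷_) (weightOne-complete x eq))))
weightOne-complete (𝟏 ∷ x)  eq = here (cong (𝟏 ∷_) (weight≡0⇒𝟘 x (ℕₚ.suc-injective eq)))
weightOne-complete (ω ∷ x)  eq = there (here (cong (ω ∷_) (weight≡0⇒𝟘 x (ℕₚ.suc-injective eq))))
weightOne-complete (ω² ∷ x) eq = there (there (here (cong (ω² ∷_) (weight≡0⇒𝟘 x (ℕₚ.suc-injective eq)))))

weightOne-sound : ∀ n → All (λ x → weight x ≡ 1) (weightOne n)
weightOne-sound zero    = []
weightOne-sound (suc n) = w ∷ w ∷ w ∷ Allₚ.map⁺ (weightOne-sound n)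
  where w = cong suc (weight-𝟘 n)

-- Numbering of words.

toFin : F4 → Fin 4
toFin 𝟎  = zero
toFin 𝟏  = suc zero
toFin ω  = suc (suc zero)
toFin ω² = suc (suc (suc zero))

fromFin : Fin 4 → F4
fromFin zero                   = 𝟎
fromFin (suc zero)             = 𝟏
fromFin (suc (suc zero))       = ω
fromFin (suc (suc (suc zero))) = ω²

fromFin-toFin : ∀ a → fromFin (toFin a) ≡ a
fromFin-toFin = toWitness {a? = ∀F4? λ a → fromFin (toFin a) ≟F4 a} _

toFin-fromFin : ∀ i → toFin (fromFin i) ≡ i
toFin-fromFin = toWitness {a? = Finₚ.all? λ i → toFin (fromFin i) Finₚ.≟ i} _

-- Base-4 digits, the first coordinate being the most significant. The zero word has number `zero`.
word : ∀ {n} → Fin (4 ^ n) → Word n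
word {zero}  _ = []
word {suc n} i = fromFin (proj₁ (remQuot {4} (4 ^ n) i)) ∷ word (proj₂ (remQuot {4} (4 ^ n) i))

index : ∀ {n} → Word n → Fin (4 ^ n)
index []      = zero
index (a ∷ x) = combine (toFin a) (index x)

word-index : ∀ {n} (x : Word n) → word (index x) ≡ x
word-index []              = refl
word-index {suc n} (a ∷ x) = trans
  (cong (λ p → fromFin (proj₁ p) ∷ word (proj₂ p)) (Finₚ.remQuot-combine {4} {4 ^ n} (toFin a) (index x)))
  (cong₂ _∷_ (fromFin-toFin a) (word-index x))

index-word : ∀ {n} (i : Fin (4 ^ n)) → index (word {n} i) ≡ i
index-word {zero}  zero = refl
index-word {suc n} i    = trans
  (cong₂ combine (toFin-fromFin (proj₁ (remQuot {4} (4 ^ n) i))) (index-word {n} (proj₂ (remQuot {4} (4 ^ n) i))))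
  (Finₚ.combine-remQuot {4} (4 ^ n) i)

word-injective : ∀ {n} {i j : Fin (4 ^ n)} → word {n} i ≡ word j → i ≡ j
word-injective {n} {i} {j} eq = trans (sym (index-word {n} i)) (trans (cong index eq) (index-word {n} j))

-- Rational sums and orthogonal eigenbases

module Spectra where

  open import Data.Rational using (mkℚ; _+_; _*_; -_; 1/_; ≢-nonZero)

  module ∑ = Algebra.Properties.Semiring.Sum (CommutativeRing.semiring ℚₚ.+-*-commutativeRing)

  sumℚ≡sum : ∀ {n} (f : Fin n → ℚ) → sumℚ f ≡ ∑.sum f
  sumℚ≡sum {zero}  f = refl
  sumℚ≡sum {suc n} f = cong (f zero +_) (sumℚ≡sum (f ∘ suc))

  sumℚ-cong : ∀ {n} {f g : Fin n → ℚ} → f ≗ g → sumℚ f ≡ sumℚ g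
  sumℚ-cong {zero}  f≗g = refl
  sumℚ-cong {suc n} f≗g = cong₂ _+_ (f≗g zero) (sumℚ-cong (f≗g ∘ suc))

  sumℚ-distrib-+ : ∀ {n} (f g : Fin n → ℚ) → sumℚ (λ i → f i + g i) ≡ sumℚ f + sumℚ g
  sumℚ-distrib-+ f g = trans (sumℚ≡sum (λ i → f i + g i))
    (trans (∑.∑-distrib-+ f g) (sym (cong₂ _+_ (sumℚ≡sum f) (sumℚ≡sum g))))

  *-distribˡ-sumℚ : ∀ {n} x (f : Fin n → ℚ) → x * sumℚ f ≡ sumℚ (λ i → x * f i)
  *-distribˡ-sumℚ x f = trans (cong (x *_) (sumℚ≡sum f))
    (trans (∑.*-distribˡ-sum x f) (sym (sumℚ≡sum (λ i → x * f i))))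

  *-distribʳ-sumℚ : ∀ {n} x (f : Fin n → ℚ) → sumℚ f * x ≡ sumℚ (λ i → f i * x)
  *-distribʳ-sumℚ x f = trans (cong (_* x) (sumℚ≡sum f))
    (trans (∑.*-distribʳ-sum x f) (sym (sumℚ≡sum (λ i → f i * x))))

  sumℚ-comm : ∀ {m n} (f : Fin m → Fin n → ℚ) →
              sumℚ (λ i → sumℚ (f i)) ≡ sumℚ (λ j → sumℚ (λ i → f i j))
  sumℚ-comm f = begin
    sumℚ (λ i → sumℚ (f i))             ≡⟨ sumℚ-cong (λ i → sumℚ≡sum (f i)) ⟩
    sumℚ (λ i → ∑.sum (f i))            ≡⟨ sumℚ≡sum (λ i → ∑.sum (f i)) ⟩
    ∑.sum (λ i → ∑.sum (f i))           ≡⟨ ∑.∑-comm f ⟩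
    ∑.sum (λ j → ∑.sum (λ i → f i j))   ≡⟨ sumℚ≡sum (λ j → ∑.sum (λ i → f i j)) ⟨
    sumℚ (λ j → ∑.sum (λ i → f i j))    ≡⟨ sumℚ-cong (λ j → sumℚ≡sum (λ i → f i j)) ⟨
    sumℚ (λ j → sumℚ (λ i → f i j))     ∎

  sumℚ-permute : ∀ {n} (f : Fin n → ℚ) (π : Permutation′ n) → sumℚ f ≡ sumℚ (λ i → f (π ⟨$⟩ʳ i))
  sumℚ-permute f π = trans (sumℚ≡sum f)
    (trans (∑.sum-permute f π) (sym (sumℚ≡sum (λ i → f (π ⟨$⟩ʳ i)))))

  sumℚ-zero : ∀ {n} {f : Fin n → ℚ} → (∀ i → f i ≡ 0ℚ) → sumℚ f ≡ 0ℚ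
  sumℚ-zero {zero}  f≡0 = refl
  sumℚ-zero {suc n} f≡0 = trans (cong₂ _+_ (f≡0 zero) (sumℚ-zero (f≡0 ∘ suc))) (ℚₚ.+-identityˡ 0ℚ)

  sumℚ-single : ∀ {n} {f : Fin n → ℚ} (i : Fin n) → (∀ j → j ≢ i → f j ≡ 0ℚ) → sumℚ f ≡ f i
  sumℚ-single {f = f} zero    f≡0 = trans (cong (f zero +_) (sumℚ-zero (λ j → f≡0 (suc j) λ ()))) (ℚₚ.+-identityʳ (f zero))
  sumℚ-single (suc i) f≡0 = trans
    (cong₂ _+_ (f≡0 zero λ ()) (sumℚ-single i (λ j j≢i → f≡0 (suc j) (j≢i ∘ Finₚ.suc-injective))))
    (ℚₚ.+-identityˡ _)

  -- Given directly in lowest terms, so that injectivity is read off the numerator and closed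
  -- instances compute.
  ι : ℕ → ℚ
  ι n = mkℚ (ℤ.+ n) 0 (Coprimality.sym (Coprimality.1-coprimeTo n))

  ι-injective : ∀ {m n} → ι m ≡ ι n → m ≡ n
  ι-injective eq = ℤₚ.+-injective (cong ℚ.numerator eq)

  ι-+ : ∀ m n → ι (m ℕ.+ n) ≡ ι m + ι n
  ι-+ m n = ℚₚ.toℚᵘ-injective (ℚᵘₚ.≃-sym (ℚᵘₚ.≃-trans (ℚₚ.toℚᵘ-homo-+ (ι m) (ι n))
    (ℚᵘ.*≡* (cong (ℤ._* ℤ.+ 1) (cong₂ ℤ._+_ (ℤₚ.*-identityʳ (ℤ.+ m)) (ℤₚ.*-identityʳ (ℤ.+ n)))))))

  indicator : Bool → ℚ
  indicator b = if b then 1ℚ else 0ℚ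

  indicator-∧ : ∀ b c → indicator (b ∧ c) ≡ indicator b * indicator c
  indicator-∧ true  c = sym (ℚₚ.*-identityˡ _)
  indicator-∧ false c = sym (ℚₚ.*-zeroˡ (indicator c))

  -- The form in which two different multipliers force a quantity to vanish: first for inner
  -- products of eigenvectors, then for sums of nontrivial characters.
  *-cancelʳ-≢ : ∀ {p q} r → p ≢ q → p * r ≡ q * r → r ≡ 0ℚ
  *-cancelʳ-≢ {p} {q} r p≢q pr≡qr with r ℚₚ.≟ 0ℚ
  ... | yes r≡0 = r≡0
  ... | no  r≢0 = contradiction (trans (sym (undo p)) (trans (cong (_* 1/ r) pr≡qr) (undo q))) p≢q
    where
    instance _ = ≢-nonZero r≢0
    undo : ∀ s → s * r * 1/ r ≡ s
    undo s = trans (ℚₚ.*-assoc s r (1/ r)) (trans (cong (s *_) (ℚₚ.*-inverseʳ r)) (ℚₚ.*-identityʳ s))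

  lookup-injective : ∀ {A : Set} {xs : List A} → Unique xs → ∀ i j → lookup xs i ≡ lookup xs j → i ≡ j
  lookup-injective (x∉xs ∷ _) zero    zero    eq = refl
  lookup-injective (x∉xs ∷ _) zero    (suc j) eq = contradiction eq (All.lookup x∉xs (∈-lookup j))
  lookup-injective (x∉xs ∷ _) (suc i) zero    eq = contradiction (sym eq) (All.lookup x∉xs (∈-lookup i))
  lookup-injective (_ ∷ uxs)  (suc i) (suc j) eq = cong suc (lookup-injective uxs i j eq)

  module _ {A : Set} {P : A → Set} (P? : Decidable P) where

    -- Passes from a family indexed by positions in a filtered list to a weighted sum over all
    -- indices. With `tabulate g` in place of `allFin n`, the tail of the list has the same form and
    -- induction applies.
    sumℚ-filter : ∀ {n} (g : Fin n → A) (f : A → ℚ) →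
      sumℚ (λ k → f (lookup (filter P? (tabulate g)) k)) ≡ sumℚ (λ i → indicator (does (P? (g i))) * f (g i))
    sumℚ-filter {zero}  g f = refl
    sumℚ-filter {suc n} g f with does (P? (g zero))
    ... | true  = cong₂ _+_ (sym (ℚₚ.*-identityˡ (f (g zero)))) (sumℚ-filter (g ∘ suc) f)
    ... | false = trans (sumℚ-filter (g ∘ suc) f)
      (sym (trans (cong (_+ rest) (ℚₚ.*-zeroˡ (f (g zero)))) (ℚₚ.+-identityˡ rest)))
      where rest = sumℚ (λ i → indicator (does (P? (g (suc i)))) * f (g (suc i)))

    ι-length-filter : ∀ {n} (g : Fin n → A) →
      ι (length (filter P? (tabulate g))) ≡ sumℚ (λ i → indicator (does (P? (g i))))
    ι-length-filter {zero}  g = refl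
    ι-length-filter {suc n} g with does (P? (g zero))
    ... | true  = trans (ι-+ 1 _) (cong (1ℚ +_) (ι-length-filter (g ∘ suc)))
    ... | false = trans (ι-length-filter (g ∘ suc)) (sym (ℚₚ.+-identityˡ _))

  -- Inner products and orthogonal bases.

  ⟨_,_⟩ : ∀ {n} → (Fin n → ℚ) → (Fin n → ℚ) → ℚ
  ⟨ u , v ⟩ = sumℚ (λ x → u x * v x)

  ⟨⟩-comm : ∀ {n} (u v : Fin n → ℚ) → ⟨ u , v ⟩ ≡ ⟨ v , u ⟩
  ⟨⟩-comm u v = sumℚ-cong (λ x → ℚₚ.*-comm (u x) (v x))

  ⟨⟩-+ˡ : ∀ {n} (u v w : Fin n → ℚ) → ⟨ (λ x → u x + v x) , w ⟩ ≡ ⟨ u , w ⟩ + ⟨ v , w ⟩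
  ⟨⟩-+ˡ u v w = trans (sumℚ-cong (λ x → ℚₚ.*-distribʳ-+ (w x) (u x) (v x)))
    (sumℚ-distrib-+ (λ x → u x * w x) (λ x → v x * w x))

  ⟨⟩-*ˡ : ∀ {n} q (u w : Fin n → ℚ) → ⟨ (λ x → q * u x) , w ⟩ ≡ q * ⟨ u , w ⟩
  ⟨⟩-*ˡ q u w = trans (sumℚ-cong (λ x → ℚₚ.*-assoc q (u x) (w x)))
    (sym (*-distribˡ-sumℚ q (λ x → u x * w x)))

  ⟨⟩-·ˡ : ∀ {m n} (c : Fin m → ℚ) (B : Fin m → Fin n → ℚ) (w : Fin n → ℚ) →
          ⟨ lincomb c B , w ⟩ ≡ sumℚ (λ k → c k * ⟨ B k , w ⟩)
  ⟨⟩-·ˡ c B w = begin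
    sumℚ (λ x → sumℚ (λ k → c k * B k x) * w x)     ≡⟨ sumℚ-cong (λ x → *-distribʳ-sumℚ (w x) (λ k → c k * B k x)) ⟩
    sumℚ (λ x → sumℚ (λ k → c k * B k x * w x))     ≡⟨ sumℚ-comm (λ x k → c k * B k x * w x) ⟩
    sumℚ (λ k → sumℚ (λ x → c k * B k x * w x))     ≡⟨ sumℚ-cong (λ k → ⟨⟩-*ˡ (c k) (B k) w) ⟩
    sumℚ (λ k → c k * ⟨ B k , w ⟩)                  ∎

  ·-adjoint : ∀ {n} (A : Fin n → Fin n → ℚ) → (∀ x y → A x y ≡ A y x) →
              ∀ u v → ⟨ A · u , v ⟩ ≡ ⟨ u , A · v ⟩
  ·-adjoint A A-sym u v = begin
    sumℚ (λ x → (A · u) x * v x)       ≡⟨ sumℚ-cong (λ x → cong (_* v x) (sumℚ-cong (λ y → trans (cong (_* u y) (A-sym x y)) (ℚₚ.*-comm (A y x) (u y))))) ⟩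
    ⟨ lincomb u A , v ⟩                ≡⟨ ⟨⟩-·ˡ u A v ⟩
    sumℚ (λ y → u y * ⟨ A y , v ⟩)     ∎

  scalarδ : ∀ {n} → ℚ → Fin n → Fin n → ℚ
  scalarδ N a b = if does (a ≟ b) then N else 0ℚ

  sumℚ-scalarδ : ∀ {n} N (f : Fin n → ℚ) b → sumℚ (λ a → f a * scalarδ N a b) ≡ f b * N
  sumℚ-scalarδ N f b = trans
    (sumℚ-single b (λ a a≢b → trans (cong (λ t → f a * (if t then N else 0ℚ)) (dec-false (a ≟ b) a≢b)) (ℚₚ.*-zeroʳ (f a))))
    (cong (λ t → f b * (if t then N else 0ℚ)) (dec-true (b ≟ b) refl))

  module OrthogonalBasis {ν} (χ : Fin ν → Fin ν → ℚ) (χ-sym : ∀ a x → χ a x ≡ χ x a)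
    (N N⁻¹ : ℚ) (N⁻¹*N : N⁻¹ * N ≡ 1ℚ)
    (χ-orthogonal : ∀ a b → ⟨ χ a , χ b ⟩ ≡ scalarδ N a b) where

    *N-cancel : ∀ q → N⁻¹ * (q * N) ≡ q
    *N-cancel q = begin
      N⁻¹ * (q * N)   ≡⟨ cong (N⁻¹ *_) (ℚₚ.*-comm q N) ⟩
      N⁻¹ * (N * q)   ≡⟨ ℚₚ.*-assoc N⁻¹ N q ⟨
      N⁻¹ * N * q     ≡⟨ cong (_* q) N⁻¹*N ⟩
      1ℚ * q          ≡⟨ ℚₚ.*-identityˡ q ⟩
      q               ∎

    -- Fourier inversion. Symmetry of `χ` turns the orthogonality of its rows into that of its
    -- columns, which collapses the double sum; no dimension argument enters.
    expansion : ∀ v x → sumℚ (λ a → N⁻¹ * ⟨ v , χ a ⟩ * χ a x) ≡ v x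
    expansion v x = begin
      sumℚ (λ a → N⁻¹ * ⟨ v , χ a ⟩ * χ a x)     ≡⟨ ⟨⟩-*ˡ N⁻¹ (λ a → ⟨ v , χ a ⟩) (λ a → χ a x) ⟩
      N⁻¹ * sumℚ (λ a → ⟨ v , χ a ⟩ * χ a x)     ≡⟨ cong (N⁻¹ *_) (⟨⟩-·ˡ v (λ y a → χ a y) (λ a → χ a x)) ⟩
      N⁻¹ * sumℚ (λ y → v y * ⟨ (λ a → χ a y) , (λ a → χ a x) ⟩)
        ≡⟨ cong (N⁻¹ *_) (sumℚ-cong (λ y → cong (v y *_) (trans
             (sumℚ-cong (λ a → cong₂ _*_ (χ-sym a y) (χ-sym a x))) (χ-orthogonal y x)))) ⟩
      N⁻¹ * sumℚ (λ y → v y * scalarδ N y x)     ≡⟨ cong (N⁻¹ *_) (sumℚ-scalarδ N v x) ⟩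
      N⁻¹ * (v x * N)                            ≡⟨ *N-cancel (v x) ⟩
      v x                                        ∎

    coefficients-unique : ∀ {u v} → (∀ a → ⟨ u , χ a ⟩ ≡ ⟨ v , χ a ⟩) → u ≗ v
    coefficients-unique {u} {v} û≡v̂ x = begin
      u x                                        ≡⟨ expansion u x ⟨
      sumℚ (λ a → N⁻¹ * ⟨ u , χ a ⟩ * χ a x)     ≡⟨ sumℚ-cong (λ a → cong (λ q → N⁻¹ * q * χ a x) (û≡v̂ a)) ⟩
      sumℚ (λ a → N⁻¹ * ⟨ v , χ a ⟩ * χ a x)     ≡⟨ expansion v x ⟩
      v x                                        ∎

    module _ (A : Fin ν → Fin ν → ℚ) (A-sym : ∀ x y → A x y ≡ A y x)
      (ev : Fin ν → ℚ) (χ-eigen : ∀ a → IsEigenvector A (ev a) (χ a)) where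

      -- Self-adjointness moves `A` across the inner product, so multiplying it by `ev a` or by `θ`
      -- gives the same result.
      eigenvector-⊥ : ∀ {θ v} → IsEigenvector A θ v → ∀ a → ev a ≢ θ → ⟨ v , χ a ⟩ ≡ 0ℚ
      eigenvector-⊥ {θ} {v} Av≡θv a ev≢θ = *-cancelʳ-≢ _ ev≢θ (begin
        ev a * ⟨ v , χ a ⟩                  ≡⟨ cong (ev a *_) (⟨⟩-comm v (χ a)) ⟩
        ev a * ⟨ χ a , v ⟩                  ≡⟨ ⟨⟩-*ˡ (ev a) (χ a) v ⟨
        ⟨ (λ x → ev a * χ a x) , v ⟩        ≡⟨ sumℚ-cong (λ x → cong (_* v x) (χ-eigen a x)) ⟨
        ⟨ A · χ a , v ⟩                     ≡⟨ ·-adjoint A A-sym (χ a) v ⟩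
        ⟨ χ a , A · v ⟩                     ≡⟨ ⟨⟩-comm (χ a) (A · v) ⟩
        ⟨ A · v , χ a ⟩                     ≡⟨ sumℚ-cong (λ x → cong (_* χ a x) (Av≡θv x)) ⟩
        ⟨ (λ x → θ * v x) , χ a ⟩           ≡⟨ ⟨⟩-*ˡ θ v (χ a) ⟩
        θ * ⟨ v , χ a ⟩                     ∎)

      -- The eigenspace of `θ` has the `χ a` with eigenvalue `θ` as a basis. `P` stands in for
      -- `ev a ≡ θ`, so that the dimension can be counted through a condition on natural numbers.
      multiplicity : ∀ θ {P : Fin ν → Set} (P? : Decidable P) →
        (∀ a → P a → ev a ≡ θ) → (∀ a → ¬ P a → ev a ≢ θ) → EigenMultiplicity A θ (count P?)
      multiplicity θ {P} P? P⇒≡ ¬P⇒≢ = B , B-eigen , B-independent , B-spans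
        where
        L = filter P? (allFin ν)

        L-unique : Unique L
        L-unique = Uniqueₚ.filter⁺ P? (Uniqueₚ.allFin⁺ ν)

        B : Fin (length L) → Fin ν → ℚ
        B k = χ (lookup L k)

        B-eigen : ∀ k → IsEigenvector A θ (B k)
        B-eigen k x = trans (χ-eigen (lookup L k) x)
          (cong (_* B k x) (P⇒≡ _ (proj₂ (∈-filter⁻ P? {xs = allFin ν} (∈-lookup k)))))

        B-orthogonal : ∀ k l → ⟨ B k , B l ⟩ ≡ scalarδ N k l
        B-orthogonal k l = trans (χ-orthogonal (lookup L k) (lookup L l))
          (cong (λ t → if t then N else 0ℚ)
            (does-⇔ (mk⇔ (lookup-injective L-unique k l) (cong (lookup L))) (lookup L k ≟ lookup L l) (k ≟ l)))

        B-independent : ∀ c → (∀ x → lincomb c B x ≡ 0ℚ) → ∀ k → c k ≡ 0ℚ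
        -- Pairing the combination with `B l` isolates `c l`.
        B-independent c cB≡0 l = begin
          c l                                        ≡⟨ *N-cancel (c l) ⟨
          N⁻¹ * (c l * N)                            ≡⟨ cong (N⁻¹ *_) (sumℚ-scalarδ N c l) ⟨
          N⁻¹ * sumℚ (λ k → c k * scalarδ N k l)     ≡⟨ cong (N⁻¹ *_) (sumℚ-cong (λ k → cong (c k *_) (B-orthogonal k l))) ⟨
          N⁻¹ * sumℚ (λ k → c k * ⟨ B k , B l ⟩)     ≡⟨ cong (N⁻¹ *_) (⟨⟩-·ˡ c B (B l)) ⟨
          N⁻¹ * ⟨ lincomb c B , B l ⟩                ≡⟨ cong (N⁻¹ *_) (sumℚ-zero (λ x → trans (cong (_* B l x) (cB≡0 x)) (ℚₚ.*-zeroˡ (B l x)))) ⟩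
          N⁻¹ * 0ℚ                                   ≡⟨ ℚₚ.*-zeroʳ N⁻¹ ⟩
          0ℚ                                         ∎

        B-spans : ∀ v → IsEigenvector A θ v → Σ (Fin (length L) → ℚ) λ c → ∀ x → lincomb c B x ≡ v x
        -- These are the Fourier coefficients of `v` on the selected characters; the other terms of
        -- its expansion vanish by `eigenvector-⊥`.
        B-spans v Av≡θv = (λ k → N⁻¹ * ⟨ v , B k ⟩) , λ x →
          trans (sumℚ-filter P? (λ a → a) (term x)) (trans (sumℚ-cong (drop x)) (expansion v x))
          where
          term : Fin ν → Fin ν → ℚ
          term x a = N⁻¹ * ⟨ v , χ a ⟩ * χ a x

          drop : ∀ x a → indicator (does (P? a)) * term x a ≡ term x a
          drop x a with P? a
          ... | yes _  = ℚₚ.*-identityˡ _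
          ... | no ¬Pa = trans (ℚₚ.*-zeroˡ (term x a)) (sym (trans
            (cong (λ q → N⁻¹ * q * χ a x) (eigenvector-⊥ Av≡θv a (¬P⇒≢ a ¬Pa)))
            (trans (cong (_* χ a x) (ℚₚ.*-zeroʳ N⁻¹)) (ℚₚ.*-zeroˡ (χ a x)))))

  -- Cayley graphs of F₄ⁿ

  -- The trace Hermitian form tr(a b²), which is the symplectic form in the coordinates `bit₁`,
  -- `bit₂`. It is `true` exactly when both arguments are nonzero and distinct.
  symp : F4 → F4 → Bool
  symp a b = (bit₁ a ∧ bit₂ b) xor (bit₂ a ∧ bit₁ b)

  symp-sym : ∀ a b → symp a b ≡ symp b a
  symp-sym = toWitness {a? = ∀F4? λ a → ∀F4? λ b → symp a b Boolₚ.≟ symp b a} _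

  symp-⊹ : ∀ a b c → symp a (b ⊹ c) ≡ symp a b xor symp a c
  symp-⊹ = toWitness {a? = ∀F4? λ a → ∀F4? λ b → ∀F4? λ c → symp a (b ⊹ c) Boolₚ.≟ (symp a b xor symp a c)} _

  module xor = Algebra.Properties.CommutativeSemigroup
    (CommutativeRing.+-commutativeSemigroup Boolₚ.xor-∧-commutativeRing)

  form : ∀ {n} → Word n → Word n → Bool
  form []      []      = false
  form (a ∷ x) (b ∷ y) = symp a b xor form x y

  form-sym : ∀ {n} (x y : Word n) → form x y ≡ form y x
  form-sym []      []      = refl
  form-sym (a ∷ x) (b ∷ y) = cong₂ _xor_ (symp-sym a b) (form-sym x y)

  form-⊕ : ∀ {n} (x y z : Word n) → form x (y ⊕ z) ≡ form x y xor form x z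
  form-⊕ []      []      []      = refl
  form-⊕ (a ∷ x) (b ∷ y) (c ∷ z) =
    trans (cong₂ _xor_ (symp-⊹ a b c) (form-⊕ x y z)) (xor.interchange (symp a b) (symp a c) (form x y) (form x z))

  form-𝟘ˡ : ∀ {n} (y : Word n) → form 𝟘 y ≡ false
  form-𝟘ˡ []      = refl
  form-𝟘ˡ (b ∷ y) = form-𝟘ˡ y

  sign : Bool → ℚ
  sign b = if b then - 1ℚ else 1ℚ

  sign-xor : ∀ b c → sign (b xor c) ≡ sign b * sign c
  sign-xor true  true  = refl
  sign-xor true  false = refl
  sign-xor false true  = refl
  sign-xor false false = refl

  -- The additive group has exponent 2, so its characters take the values ±1 and rational
  -- coefficients suffice.
  char : ∀ {n} → Word n → Word n → ℚ
  char x y = sign (form x y)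

  char-sym : ∀ {n} (x y : Word n) → char x y ≡ char y x
  char-sym x y = cong sign (form-sym x y)

  char-⊕ : ∀ {n} (x y z : Word n) → char x (y ⊕ z) ≡ char x y * char x z
  char-⊕ x y z = trans (cong sign (form-⊕ x y z)) (sign-xor (form x y) (form x z))

  symp-nondegenerate : ∀ a → a ≡ 𝟎 ⊎ ∃ λ b → symp a b ≡ true
  symp-nondegenerate = toWitness {a? = ∀F4? λ a → (a ≟F4 𝟎) ⊎-dec ∃F4? λ b → symp a b Boolₚ.≟ true} _

  form-nondegenerate : ∀ {n} (x : Word n) → x ≡ 𝟘 ⊎ ∃ λ y → form x y ≡ true
  form-nondegenerate []      = inj₁ refl
  form-nondegenerate (a ∷ x) with symp-nondegenerate a | form-nondegenerate x
  ... | inj₂ (b , ab≡t) | _               =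
    inj₂ (b ∷ 𝟘 , cong₂ _xor_ ab≡t (trans (form-sym x 𝟘) (form-𝟘ˡ x)))
  ... | inj₁ refl       | inj₁ refl       = inj₁ refl
  ... | inj₁ refl       | inj₂ (y , xy≡t) = inj₂ (𝟎 ∷ y , xy≡t)

  sumℚ-1 : ∀ m → sumℚ {m} (λ _ → 1ℚ) ≡ ι m
  sumℚ-1 zero    = refl
  sumℚ-1 (suc m) = trans (cong (1ℚ +_) (sumℚ-1 m)) (sym (ι-+ 1 m))

  ι≢0 : ∀ {m} .{{_ : ℕ.NonZero m}} → ι m ≢ 0ℚ
  ι≢0 {suc m} eq = contradiction (ι-injective {n = 0} eq) λ ()

  -- Orthogonality of characters.

  module Characters (n : ℕ) where

    ν : ℕ
    ν = 4 ^ n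

    origin : Fin ν
    origin = index (𝟘 {n})

    vec : Fin ν → Word n
    vec = word

    translate : Fin ν → Fin ν → Fin ν
    translate x y = index (vec x ⊕ vec y)

    vec-translate : ∀ x y → vec (translate x y) ≡ vec x ⊕ vec y
    vec-translate x y = word-index (vec x ⊕ vec y)

    translate-involutive : ∀ x y → translate x (translate x y) ≡ y
    translate-involutive x y = word-injective {n} (begin
      vec (translate x (translate x y))   ≡⟨ vec-translate x (translate x y) ⟩
      vec x ⊕ vec (translate x y)         ≡⟨ cong (vec x ⊕_) (vec-translate x y) ⟩
      vec x ⊕ (vec x ⊕ vec y)             ≡⟨ ⊕-cancelˡ (vec x) (vec y) ⟩
      vec y                               ∎)

    -- Translation is an involution in characteristic 2, hence a permutation of the vertices.
    sumℚ-translate : ∀ x (f : Fin ν → ℚ) → sumℚ f ≡ sumℚ (λ y → f (translate x y))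
    sumℚ-translate x f = sumℚ-permute f
      (permutation (translate x) (translate x) (translate-involutive x) (translate-involutive x))

    χ : Fin ν → Fin ν → ℚ
    χ a x = char (vec a) (vec x)

    χ-sym : ∀ a x → χ a x ≡ χ x a
    χ-sym a x = char-sym (vec a) (vec x)

    χ-translate : ∀ a x y → χ a (translate x y) ≡ χ a x * χ a y
    χ-translate a x y = trans (cong (char (vec a)) (vec-translate x y)) (char-⊕ (vec a) (vec x) (vec y))

    χ-origin : ∀ x → χ origin x ≡ 1ℚ
    χ-origin x = trans (cong (λ v → char v (vec x)) (word-index (𝟘 {n}))) (cong sign (form-𝟘ˡ (vec x)))

    -- Translation by y multiplies the sum by the value −1 of the character at y.
    χ-sum-nontrivial : ∀ {a y} → form (vec a) y ≡ true → sumℚ (χ a) ≡ 0ℚ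
    χ-sum-nontrivial {a} {y} form≡true = *-cancelʳ-≢ {1ℚ} {(- 1ℚ)} (sumℚ (χ a)) (λ ()) (begin
      1ℚ * sumℚ (χ a)                           ≡⟨ ℚₚ.*-identityˡ (sumℚ (χ a)) ⟩
      sumℚ (χ a)                                ≡⟨ sumℚ-translate (index y) (χ a) ⟩
      sumℚ (λ x → χ a (translate (index y) x))  ≡⟨ sumℚ-cong (χ-translate a (index y)) ⟩
      sumℚ (λ x → χ a (index y) * χ a x)        ≡⟨ *-distribˡ-sumℚ (χ a (index y)) (χ a) ⟨
      χ a (index y) * sumℚ (χ a)                ≡⟨ cong (λ v → char (vec a) v * sumℚ (χ a)) (word-index y) ⟩
      char (vec a) y * sumℚ (χ a)               ≡⟨ cong (λ b → sign b * sumℚ (χ a)) form≡true ⟩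
      - 1ℚ * sumℚ (χ a)                         ∎)

    χ-sum : ∀ a → sumℚ (χ a) ≡ scalarδ (ι ν) a origin
    χ-sum a = go (a ≟ origin)
      where
      go : (d : Dec (a ≡ origin)) → sumℚ (χ a) ≡ (if does d then ι ν else 0ℚ)
      go (yes refl) = trans (sumℚ-cong χ-origin) (sumℚ-1 ν)
      go (no a≢0) with form-nondegenerate (vec a)
      ... | inj₁ a≡𝟘 = contradiction (word-injective {n} (trans a≡𝟘 (sym (word-index (𝟘 {n}))))) a≢0
      ... | inj₂ (y , form≡true) = χ-sum-nontrivial form≡true

    -- By symmetry the product of the characters of `a` and `b` is the character of their sum, which
    -- leaves a single character sum. The sum of `a` and `b` is the origin exactly when `a` and `b`
    -- agree.
    χ-orthogonal : ∀ a b → ⟨ χ a , χ b ⟩ ≡ scalarδ (ι ν) a b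
    χ-orthogonal a b = begin
      sumℚ (λ x → χ a x * χ b x)            ≡⟨ sumℚ-cong (λ x → cong₂ _*_ (χ-sym a x) (χ-sym b x)) ⟩
      sumℚ (λ x → χ x a * χ x b)            ≡⟨ sumℚ-cong (λ x → χ-translate x a b) ⟨
      sumℚ (λ x → χ x (translate a b))      ≡⟨ sumℚ-cong (λ x → χ-sym x (translate a b)) ⟩
      sumℚ (χ (translate a b))              ≡⟨ χ-sum (translate a b) ⟩
      scalarδ (ι ν) (translate a b) origin  ≡⟨ cong (if_then ι ν else 0ℚ) (does-⇔ (mk⇔ to from) (translate a b ≟ origin) (a ≟ b)) ⟩
      scalarδ (ι ν) a b                     ∎
      where
      to : translate a b ≡ origin → a ≡ b
      to eq = word-injective {n} (⊕≡𝟘⇒≡ (trans (sym (vec-translate a b)) (trans (cong vec eq) (word-index (𝟘 {n})))))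
      from : a ≡ b → translate a b ≡ origin
      from refl = cong index (⊕-self (vec a))

    instance
      ιν≢0 : ℚ.NonZero (ι ν)
      ιν≢0 = ℚ.≢-nonZero (ι≢0 {{ℕₚ.m^n≢0 4 n}})

    open OrthogonalBasis χ χ-sym (ι ν) (1/ ι ν) (ℚₚ.*-inverseˡ (ι ν)) χ-orthogonal public

  -- Eigenvalues of Cayley graphs and strong regularity.

  charge : ∀ {n} → Word n → List (Word n) → ℕ
  charge a []      = 0
  charge a (p ∷ S) = if form a p then suc (charge a S) else charge a S

  charSum : ∀ {n} → Word n → List (Word n) → ℚ
  charSum a = foldr (λ p q → char a p + q) 0ℚ

  module ℚ+ = Algebra.Properties.CommutativeSemigroup
    (CommutativeRing.+-commutativeSemigroup ℚₚ.+-*-commutativeRing)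

  module ℚ+ᴳ = Algebra.Properties.Group ℚₚ.+-0-group

  -- A word counted by `charge` contributes -1 to the character sum and any other word 1. Stated
  -- without subtraction, so that the charge remains a natural number.
  charSum-charge : ∀ {n} (a : Word n) S → charSum a S + ι (2 ℕ.* charge a S) ≡ ι (length S)
  charSum-charge a []      = refl
  charSum-charge a (p ∷ S) = trans (step (form a p)) (trans (cong (1ℚ +_) (charSum-charge a S)) (sym (ι-+ 1 (length S))))
    where
    s = charSum a S
    c = charge a S
    step : ∀ b → sign b + s + ι (2 ℕ.* (if b then suc c else c)) ≡ 1ℚ + (s + ι (2 ℕ.* c))
    step true = begin
      - 1ℚ + s + ι (2 ℕ.* suc c)        ≡⟨ cong (λ m → - 1ℚ + s + ι m) (ℕₚ.*-suc 2 c) ⟩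
      - 1ℚ + s + ι (2 ℕ.+ 2 ℕ.* c)      ≡⟨ cong (- 1ℚ + s +_) (ι-+ 2 (2 ℕ.* c)) ⟩
      -- After the interchange the first bracket is `- 1ℚ + ι 2`, which computes to `1ℚ`.
      - 1ℚ + s + (ι 2 + ι (2 ℕ.* c))    ≡⟨ ℚ+.interchange (- 1ℚ) s (ι 2) (ι (2 ℕ.* c)) ⟩
      1ℚ + (s + ι (2 ℕ.* c))            ∎
    step false = ℚₚ.+-assoc 1ℚ s (ι (2 ℕ.* c))

  charge-𝟘 : ∀ {n} (S : List (Word n)) → charge 𝟘 S ≡ 0
  charge-𝟘 []      = refl
  charge-𝟘 (p ∷ S) rewrite form-𝟘ˡ p = charge-𝟘 S

  module CayleyGraph {n : ℕ} (S : List (Word n)) (S-unique : Unique S) where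

    open Characters n public
    open DecMembership (_≟W_ {n}) using (_∈?_)

    module _ (p : Word n) (T : List (Word n)) (p∉T : All (p ≢_) T) where

      indicator-∷ : ∀ v → indicator (does (v ∈? (p ∷ T))) ≡ indicator (does (v ≟W p)) + indicator (does (v ∈? T))
      indicator-∷ v with v ≟W p
      ... | yes refl = cong (λ b → 1ℚ + indicator b) (sym (dec-false (p ∈? T) (λ p∈T → All.lookup p∉T p∈T refl)))
      ... | no  _    = sym (ℚₚ.+-identityˡ _)

    sumℚ-point : ∀ p (g : Word n → ℚ) → sumℚ (λ z → indicator (does (vec z ≟W p)) * g (vec z)) ≡ g p
    sumℚ-point p g = begin
      sumℚ (λ z → indicator (does (vec z ≟W p)) * g (vec z))
        ≡⟨ sumℚ-single (index p) (λ z z≢p → trans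
             (cong (λ b → indicator b * g (vec z)) (dec-false (vec z ≟W p) (λ z≡p → z≢p (word-injective {n} (trans z≡p (sym (word-index p)))))))
             (ℚₚ.*-zeroˡ (g (vec z)))) ⟩
      indicator (does (vec (index p) ≟W p)) * g (vec (index p))
        ≡⟨ cong₂ (λ b v → indicator b * g v) (dec-true (vec (index p) ≟W p) (word-index p)) (word-index p) ⟩
      1ℚ * g p
        ≡⟨ ℚₚ.*-identityˡ (g p) ⟩
      g p ∎

    -- Distinctness of the entries makes the membership indicator the sum of the point indicators,
    -- so nothing is counted twice.
    sumℚ-indicator : ∀ (g : Word n → ℚ) {T} → Unique T →
      sumℚ (λ z → indicator (does (vec z ∈? T)) * g (vec z)) ≡ foldr (λ p q → g p + q) 0ℚ T
    sumℚ-indicator g {[]}    []           = sumℚ-zero (λ z → ℚₚ.*-zeroˡ (g (vec z)))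
    sumℚ-indicator g {p ∷ T} (p∉T ∷ T-unique) = begin
      sumℚ (λ z → indicator (does (vec z ∈? (p ∷ T))) * g (vec z))
        ≡⟨ sumℚ-cong (λ z → cong (_* g (vec z)) (indicator-∷ p T p∉T (vec z))) ⟩
      sumℚ (λ z → (indicator (does (vec z ≟W p)) + indicator (does (vec z ∈? T))) * g (vec z))
        ≡⟨ ⟨⟩-+ˡ (λ z → indicator (does (vec z ≟W p))) (λ z → indicator (does (vec z ∈? T))) (λ z → g (vec z)) ⟩
      sumℚ (λ z → indicator (does (vec z ≟W p)) * g (vec z)) + sumℚ (λ z → indicator (does (vec z ∈? T)) * g (vec z))
        ≡⟨ cong₂ _+_ (sumℚ-point p g) (sumℚ-indicator g T-unique) ⟩
      g p + foldr (λ p q → g p + q) 0ℚ T ∎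

    ev : Fin ν → ℚ
    ev a = charSum (vec a) S

    ev-charge : ∀ a θ c → θ + ι (2 ℕ.* c) ≡ ι (length S) → charge (vec a) S ≡ c → ev a ≡ θ
    ev-charge a θ c θ+2c refl = ℚ+ᴳ.∙-cancelʳ (ι (2 ℕ.* charge (vec a) S)) (ev a) θ
      (trans (charSum-charge (vec a) S) (sym θ+2c))

    module _ {E : Rel₂ ν} (E? : Decidable₂ E) (E⇔ : ∀ x y → E x y ⇔ (vec x ⊕ vec y ∈ S)) where

      A : Fin ν → Fin ν → ℚ
      A = adjMatrix E?

      A-indicator : ∀ x y → A x y ≡ indicator (does ((vec x ⊕ vec y) ∈? S))
      A-indicator x y = cong indicator (does-⇔ (E⇔ x y) (E? x y) ((vec x ⊕ vec y) ∈? S))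

      A-sym : ∀ x y → A x y ≡ A y x
      A-sym x y = trans (A-indicator x y)
        (trans (cong (λ v → indicator (does (v ∈? S))) (⊕-comm (vec x) (vec y))) (sym (A-indicator y x)))

      -- The substitution of x + z for y turns row `x` of `A` into the indicator of `S` and splits
      -- off the factor `χ a x`; what remains is the character sum over `S`.
      χ-eigen : ∀ a → IsEigenvector A (ev a) (χ a)
      χ-eigen a x = begin
        sumℚ (λ y → A x y * χ a y)
          ≡⟨ sumℚ-translate x (λ y → A x y * χ a y) ⟩
        sumℚ (λ z → A x (translate x z) * χ a (translate x z))
          ≡⟨ sumℚ-cong (λ z → cong₂ _*_ (A-translate z) (trans (χ-translate a x z) (ℚₚ.*-comm (χ a x) (χ a z)))) ⟩
        sumℚ (λ z → indicator (does (vec z ∈? S)) * (χ a z * χ a x))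
          ≡⟨ sumℚ-cong (λ z → ℚₚ.*-assoc (indicator (does (vec z ∈? S))) (χ a z) (χ a x)) ⟨
        sumℚ (λ z → indicator (does (vec z ∈? S)) * χ a z * χ a x)
          ≡⟨ *-distribʳ-sumℚ (χ a x) (λ z → indicator (does (vec z ∈? S)) * χ a z) ⟨
        sumℚ (λ z → indicator (does (vec z ∈? S)) * χ a z) * χ a x
          ≡⟨ cong (_* χ a x) (sumℚ-indicator (char (vec a)) S-unique) ⟩
        ev a * χ a x ∎
        where
        A-translate : ∀ z → A x (translate x z) ≡ indicator (does (vec z ∈? S))
        A-translate z = trans (A-indicator x (translate x z))
          (cong (λ v → indicator (does (v ∈? S)))
            (trans (cong (vec x ⊕_) (vec-translate x z)) (⊕-cancelˡ (vec x) (vec z))))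

      eigenMultiplicity : ∀ θ c → θ + ι (2 ℕ.* c) ≡ ι (length S) →
        EigenMultiplicity A θ (count (λ a → charge (vec a) S ℕₚ.≟ c))
      eigenMultiplicity θ c θ+2c = multiplicity A A-sym ev χ-eigen θ (λ a → charge (vec a) S ℕₚ.≟ c)
        (λ a → ev-charge a θ c θ+2c)
        -- Conversely the eigenvalue determines the charge: cancel `θ`, then the factor 2.
        (λ a c′≢c ev≡θ → c′≢c (ℕₚ.*-cancelˡ-≡ _ c 2 (ι-injective (ℚ+ᴳ.∙-cancelˡ θ _ _
          (trans (cong (_+ _) (sym ev≡θ)) (trans (charSum-charge (vec a) S) (sym θ+2c)))))))

      paths : Fin ν → Fin ν → ℚ
      paths x y = sumℚ (λ k → A x k * A y k)

      ι-count-paths : ∀ x y → ι (count (λ k → E? x k ×? E? y k)) ≡ paths x y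
      ι-count-paths x y = trans (ι-length-filter (λ k → E? x k ×? E? y k) (λ k → k))
        (sumℚ-cong (λ k → trans (cong indicator (does-×? (E? x k) (E? y k))) (indicator-∧ (does (E? x k)) (does (E? y k)))))
        where
        does-×? : ∀ {P Q : Set} (p : Dec P) (q : Dec Q) → does (p ×? q) ≡ does p ∧ does q
        does-×? (yes _) (yes _) = refl
        does-×? (yes _) (no _)  = refl
        does-×? (no _)  _       = refl

      -- Since `A` is symmetric, `paths` is the square of `A`, and `χ a` is an eigenvector of it
      -- with the squared eigenvalue.
      paths-coefficient : ∀ a x → ⟨ paths x , χ a ⟩ ≡ ev a * ev a * χ a x
      paths-coefficient a x = begin
        ⟨ paths x , χ a ⟩                               ≡⟨ ⟨⟩-·ˡ (A x) (λ k y → A y k) (χ a) ⟩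
        sumℚ (λ k → A x k * ⟨ (λ y → A y k) , χ a ⟩)    ≡⟨ sumℚ-cong (λ k → cong (A x k *_) (column k)) ⟩
        sumℚ (λ k → A x k * (ev a * χ a k))             ≡⟨ sumℚ-cong (λ k → swap (A x k) (ev a) (χ a k)) ⟩
        sumℚ (λ k → ev a * (A x k * χ a k))             ≡⟨ *-distribˡ-sumℚ (ev a) (λ k → A x k * χ a k) ⟨
        ev a * sumℚ (λ k → A x k * χ a k)               ≡⟨ cong (ev a *_) (χ-eigen a x) ⟩
        ev a * (ev a * χ a x)                           ≡⟨ ℚₚ.*-assoc (ev a) (ev a) (χ a x) ⟨
        ev a * ev a * χ a x                             ∎
        where
        column : ∀ k → ⟨ (λ y → A y k) , χ a ⟩ ≡ ev a * χ a k
        column k = trans (sumℚ-cong (λ y → cong (_* χ a y) (A-sym y k))) (χ-eigen a k)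

        swap : ∀ p q r → p * (q * r) ≡ q * (p * r)
        swap p q r = trans (sym (ℚₚ.*-assoc p q r)) (trans (cong (_* r) (ℚₚ.*-comm p q)) (ℚₚ.*-assoc q p r))

      module _ (p q μ : ℕ)
        (quadratic : ∀ a → ev a * ev a + ι p * ev a ≡ ι q + scalarδ (ι μ * ι ν) a origin) where

        -- This is A² + pA = qI + μJ, proved on the coefficients of row `x`. The row of I has
        -- coefficient `χ a x`; the row of J has `ι ν` at the origin and zero elsewhere. `quadratic`
        -- is the resulting equation.
        paths-formula : ∀ x y → paths x y + ι p * A x y ≡ ι q * scalarδ 1ℚ y x + ι μ
        paths-formula x = coefficients-unique λ a → begin
          ⟨ (λ y → paths x y + ι p * A x y) , χ a ⟩
            ≡⟨ ⟨⟩-+ˡ (paths x) (λ y → ι p * A x y) (χ a) ⟩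
          ⟨ paths x , χ a ⟩ + ⟨ (λ y → ι p * A x y) , χ a ⟩
            ≡⟨ cong₂ _+_ (paths-coefficient a x) (trans (⟨⟩-*ˡ (ι p) (A x) (χ a)) (cong (ι p *_) (χ-eigen a x))) ⟩
          ev a * ev a * χ a x + ι p * (ev a * χ a x)
            ≡⟨ cong (ev a * ev a * χ a x +_) (ℚₚ.*-assoc (ι p) (ev a) (χ a x)) ⟨
          ev a * ev a * χ a x + ι p * ev a * χ a x
            ≡⟨ ℚₚ.*-distribʳ-+ (χ a x) (ev a * ev a) (ι p * ev a) ⟨
          (ev a * ev a + ι p * ev a) * χ a x
            ≡⟨ cong (_* χ a x) (quadratic a) ⟩
          (ι q + scalarδ (ι μ * ι ν) a origin) * χ a x
            ≡⟨ ℚₚ.*-distribʳ-+ (χ a x) (ι q) (scalarδ (ι μ * ι ν) a origin) ⟩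
          ι q * χ a x + scalarδ (ι μ * ι ν) a origin * χ a x
            ≡⟨ cong₂ _+_ (cong (ι q *_) (sym (point a x))) (sym (constant a x (a ≟ origin))) ⟩
          ι q * ⟨ (λ y → scalarδ 1ℚ y x) , χ a ⟩ + ⟨ (λ _ → ι μ) , χ a ⟩
            ≡⟨ cong (_+ ⟨ (λ _ → ι μ) , χ a ⟩) (⟨⟩-*ˡ (ι q) (λ y → scalarδ 1ℚ y x) (χ a)) ⟨
          ⟨ (λ y → ι q * scalarδ 1ℚ y x) , χ a ⟩ + ⟨ (λ _ → ι μ) , χ a ⟩
            ≡⟨ ⟨⟩-+ˡ (λ y → ι q * scalarδ 1ℚ y x) (λ _ → ι μ) (χ a) ⟨
          ⟨ (λ y → ι q * scalarδ 1ℚ y x + ι μ) , χ a ⟩ ∎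
          where
          point : ∀ a x → ⟨ (λ y → scalarδ 1ℚ y x) , χ a ⟩ ≡ χ a x
          point a x = trans (⟨⟩-comm (λ y → scalarδ 1ℚ y x) (χ a))
            (trans (sumℚ-scalarδ 1ℚ (χ a) x) (ℚₚ.*-identityʳ (χ a x)))

          constant : ∀ a x (d : Dec (a ≡ origin)) → ⟨ (λ _ → ι μ) , χ a ⟩ ≡ (if does d then ι μ * ι ν else 0ℚ) * χ a x
          constant a x d = trans (sym (*-distribˡ-sumℚ (ι μ) (χ a))) (trans (cong (ι μ *_) (χ-sum a)) (go d))
            where
            go : (d : Dec (a ≡ origin)) → ι μ * scalarδ (ι ν) a origin ≡ (if does d then ι μ * ι ν else 0ℚ) * χ a x
            go (yes refl) = trans (cong (λ b → ι μ * (if b then ι ν else 0ℚ)) (dec-true (origin ≟ origin) refl))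
              (sym (trans (cong (ι μ * ι ν *_) (χ-origin x)) (ℚₚ.*-identityʳ (ι μ * ι ν))))
            go (no a≢0) = trans (cong (λ b → ι μ * (if b then ι ν else 0ℚ)) (dec-false (a ≟ origin) a≢0))
              (trans (ℚₚ.*-zeroʳ (ι μ)) (sym (ℚₚ.*-zeroˡ (χ a x))))

        -- The entries of A² = qI + μJ - pA are q + μ on the diagonal, μ - p at edges and μ at
        -- non-edges.
        stronglyRegular : 𝟘 ∉ S → ∀ {λ'} → λ' ℕ.+ p ≡ μ → IsSRG ν (q ℕ.+ μ) λ' μ E E?
        stronglyRegular 𝟘∉S {λ'} λ'+p≡μ = irreflexive , symmetric , degree , walk-adjacent , walk-nonadjacent
          where
          irreflexive : ∀ x → ¬ E x x
          irreflexive x xx = 𝟘∉S (subst (_∈ S) (⊕-self (vec x)) (Equivalence.to (E⇔ x x) xx))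

          symmetric : ∀ x y → E x y → E y x
          symmetric x y xy =
            Equivalence.from (E⇔ y x) (subst (_∈ S) (⊕-comm (vec x) (vec y)) (Equivalence.to (E⇔ x y) xy))

          walk : Fin ν → Fin ν → ℕ
          walk x y = count (λ k → E? x k ×? E? y k)

          -- With the two decisions as parameters, the entries of A and I become constants in each
          -- of the three cases.
          walk-formula : ∀ {x y b c} → does (E? x y) ≡ b → does (y ≟ x) ≡ c →
            ι (walk x y) + ι p * indicator b ≡ ι q * indicator c + ι μ
          walk-formula {x} {y} refl refl = trans (cong (_+ ι p * A x y) (ι-count-paths x y)) (paths-formula x y)

          walk-nonadjacent : ∀ x y → x ≢ y → ¬ E x y → walk x y ≡ μ
          walk-nonadjacent x y x≢y ¬xy = ι-injective (begin
            ι (walk x y)              ≡⟨ ℚₚ.+-identityʳ (ι (walk x y)) ⟨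
            ι (walk x y) + 0ℚ         ≡⟨ cong (ι (walk x y) +_) (ℚₚ.*-zeroʳ (ι p)) ⟨
            ι (walk x y) + ι p * 0ℚ   ≡⟨ walk-formula (dec-false (E? x y) ¬xy) (dec-false (y ≟ x) (x≢y ∘ sym)) ⟩
            ι q * 0ℚ + ι μ            ≡⟨ cong (_+ ι μ) (ℚₚ.*-zeroʳ (ι q)) ⟩
            0ℚ + ι μ                  ≡⟨ ℚₚ.+-identityˡ (ι μ) ⟩
            ι μ                       ∎)

          walk-adjacent : ∀ x y → E x y → walk x y ≡ λ'
          walk-adjacent x y xy = ℕₚ.+-cancelʳ-≡ p (walk x y) λ' (trans (ι-injective (begin
            ι (walk x y ℕ.+ p)        ≡⟨ ι-+ (walk x y) p ⟩
            ι (walk x y) + ι p        ≡⟨ cong (ι (walk x y) +_) (ℚₚ.*-identityʳ (ι p)) ⟨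
            ι (walk x y) + ι p * 1ℚ   ≡⟨ walk-formula (dec-true (E? x y) xy) (dec-false (y ≟ x) λ { refl → irreflexive x xy }) ⟩
            ι q * 0ℚ + ι μ            ≡⟨ cong (_+ ι μ) (ℚₚ.*-zeroʳ (ι q)) ⟩
            0ℚ + ι μ                  ≡⟨ ℚₚ.+-identityˡ (ι μ) ⟩
            ι μ                       ∎)) (sym λ'+p≡μ))

          walk-closed : ∀ x → walk x x ≡ q ℕ.+ μ
          walk-closed x = ι-injective (begin
            ι (walk x x)              ≡⟨ ℚₚ.+-identityʳ (ι (walk x x)) ⟨
            ι (walk x x) + 0ℚ         ≡⟨ cong (ι (walk x x) +_) (ℚₚ.*-zeroʳ (ι p)) ⟨
            ι (walk x x) + ι p * 0ℚ   ≡⟨ walk-formula (dec-false (E? x x) (irreflexive x)) (dec-true (x ≟ x) refl) ⟩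
            ι q * 1ℚ + ι μ            ≡⟨ cong (_+ ι μ) (ℚₚ.*-identityʳ (ι q)) ⟩
            ι q + ι μ                 ≡⟨ ι-+ q μ ⟨
            ι (q ℕ.+ μ)               ∎)

          -- A closed walk of length two traverses one edge twice, so the degree is a diagonal entry
          -- of A².
          degree : ∀ x → count (E? x) ≡ q ℕ.+ μ
          degree x = trans (cong length (filter-≐ (E? x) (λ k → E? x k ×? E? x k) ((λ e → e , e) , proj₁) (allFin ν)))
            (walk-closed x)

  -- A decidable form of what the spectral argument asks of the connection set. Charges 0, 12 and 16
  -- give the eigenvalues 27, 3 and -5 through 27 - 2c.
  record TwoWeight (S : List (Word 3)) : Set where
    field
      unique   : Unique S
      nonzero  : All (𝟘 ≢_) S
      size     : length S ≡ 27
      charges  : ∀ (a : Fin 64) → a ≡ zero ⊎ charge (word a) S ≡ 12 ⊎ charge (word a) S ≡ 16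
      count-0  : count (λ (a : Fin 64) → charge (word a) S ℕₚ.≟ 0) ≡ 1
      count-12 : count (λ (a : Fin 64) → charge (word a) S ℕₚ.≟ 12) ≡ 36
      count-16 : count (λ (a : Fin 64) → charge (word a) S ℕₚ.≟ 16) ≡ 27

  twoWeight? : ∀ S → Dec (TwoWeight S)
  twoWeight? S = map′
    (λ (u , z , s , c , n₀ , n₁₂ , n₁₆) → record
      { unique = u ; nonzero = z ; size = s ; charges = c ; count-0 = n₀ ; count-12 = n₁₂ ; count-16 = n₁₆ })
    (λ t → let open TwoWeight t in unique , nonzero , size , charges , count-0 , count-12 , count-16)
    (unique? S ×-dec All.all? (λ p → ¬? (𝟘 ≟W p)) S ×-dec (length S ℕₚ.≟ 27)
      ×-dec Finₚ.all? (λ a → a ≟ zero ⊎-dec charge (word a) S ℕₚ.≟ 12 ⊎-dec charge (word a) S ℕₚ.≟ 16)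
      ×-dec (_ ℕₚ.≟ 1) ×-dec (_ ℕₚ.≟ 36) ×-dec (_ ℕₚ.≟ 27))

  module _ {S : List (Word 3)} (S-twoWeight : TwoWeight S) {E : Rel₂ 64} (E? : Decidable₂ E)
    (E⇔ : ∀ x y → E x y ⇔ ((word x ⊕ word y) ∈ S)) where

    open TwoWeight S-twoWeight
    open CayleyGraph S unique

    ev-value : ∀ a θ c → θ + ι (2 ℕ.* c) ≡ ι 27 → charge (word a) S ≡ c → ev a ≡ θ
    ev-value a θ c θ+2c = ev-charge a θ c (trans θ+2c (cong ι (sym size)))

    -- At the origin 27² + 2·27 = 783 = 15 + 12·64; otherwise 3² + 2·3 = 15 and (-5)² - 2·5 = 15.
    twoWeight-quadratic : ∀ a → ev a * ev a + ι 2 * ev a ≡ ι 15 + scalarδ (ι 12 * ι 64) a zero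
    twoWeight-quadratic a with a ≟ zero | charges a
    ... | yes refl | _              = cong (λ q → q * q + ι 2 * q) (ev-value zero (ι 27) 0 refl (charge-𝟘 S))
    ... | no a≢0 | inj₁ a≡0         = contradiction a≡0 a≢0
    ... | no _   | inj₂ (inj₁ c≡12) = cong (λ q → q * q + ι 2 * q) (ev-value a (ι 3) 12 refl c≡12)
    ... | no _   | inj₂ (inj₂ c≡16) = cong (λ q → q * q + ι 2 * q) (ev-value a (- ι 5) 16 refl c≡16)

    twoWeight-srg : IsSRG 64 27 10 12 E E?
    -- The degree is 15 + 12, and adjacent vertices have 12 - 2 common neighbours.
    twoWeight-srg = stronglyRegular E? E⇔ 2 15 12 twoWeight-quadratic (λ 𝟘∈S → All.lookup nonzero 𝟘∈S refl) refl

    twoWeight-multiplicity : ∀ θ c m → θ + ι (2 ℕ.* c) ≡ ι 27 →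
      count (λ (a : Fin 64) → charge (word a) S ℕₚ.≟ c) ≡ m → EigenMultiplicity (adjMatrix E?) θ m
    twoWeight-multiplicity θ c m θ+2c refl = eigenMultiplicity E? E⇔ θ c (trans θ+2c (cong ι (sym size)))

    twoWeight-spectrum : HasSpectrum (adjMatrix E?)
      ((ℤ→ℚ (ℤ.+ 27) , 1) ∷ (ℤ→ℚ (ℤ.+ 3) , 36) ∷ (ℤ→ℚ (ℤ.- (ℤ.+ 5)) , 27) ∷ [])
    twoWeight-spectrum =
        (twoWeight-multiplicity (ℤ→ℚ (ℤ.+ 27)) 0 1 refl count-0
        ∷ twoWeight-multiplicity (ℤ→ℚ (ℤ.+ 3)) 12 36 refl count-12
        ∷ twoWeight-multiplicity (ℤ→ℚ (ℤ.- (ℤ.+ 5))) 16 27 refl count-16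
        ∷ [])
      , refl

open Spectra
open import Data.Integer using (+_; -_)

-- Parity checks of the punctured codes

-- `puncture i j i≢j` unfolds to `delete i (punchOut i≢j)`, so the finite check can range over all
-- `i` and `k` without distinctness proofs. Any entry type is allowed, because decoder rows are
-- deleted along with the coordinates.
delete : ∀ {A : Set} {n} → Fin (suc (suc n)) → Fin (suc n) → Vec A (suc (suc n)) → Vec A n
delete i k x = removeAt (removeAt x i) k

-- σ is a syndrome map for the image of D⁻ under P, ρ picks coset representatives, and γ gives the
-- coefficients, with respect to the generators, of the codeword y − ρ (σ y).
record ParityCheck (P : Word 11 → Word 9) (σ : Vec (Word 3) 18) (ρ : Vec (Word 9) 6) (γ : Vec (Word 6) 18) : Set where
  field
    section   : All (λ u → lin {9} σ (lin {3} ρ u) ≡ u) (basis 3)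
    vanishes  : VecAll.All (λ g → lin {9} σ (P g) ≡ 𝟘) generators
    residue   : All (λ y → y ⊕ lin {3} ρ (lin {9} σ y) ≡ P (lin {6} generators (lin {9} γ y))) (basis 9)
    twoWeight : TwoWeight (map (lin {9} σ) (weightOne 9))

parityCheck? : ∀ P σ ρ γ → Dec (ParityCheck P σ ρ γ)
parityCheck? P σ ρ γ = map′
  (λ (s , v , r , t) → record { section = s ; vanishes = v ; residue = r ; twoWeight = t })
  (λ p → let open ParityCheck p in section , vanishes , residue , twoWeight)
  (All.all? (λ u → lin {9} σ (lin {3} ρ u) ≟W u) (basis 3)
    ×-dec VecAll.all? (λ g → lin {9} σ (P g) ≟W 𝟘) generators
    ×-dec All.all? (λ y → (y ⊕ lin {3} ρ (lin {9} σ y)) ≟W P (lin {6} generators (lin {9} γ y))) (basis 9)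
    ×-dec twoWeight? (map (lin {9} σ) (weightOne 9)))

-- Marks the coordinates outside the information set. Inside it the first row belongs to a codeword
-- with value `𝟏` there, hence is nonzero.
zeroRows : ∀ {m n} → Vec (Vec (Word n) 2) m → Vec Bool m
zeroRows = Vec.map (λ r → does (Vec.head r ≟W 𝟘))

-- Entries at the marked positions, padded with zeros if fewer than n are marked.
select : ∀ {m} n → Vec Bool m → Word m → Word n
select n       []          []      = 𝟘
select zero    _           _       = []
select (suc n) (true ∷ b)  (a ∷ x) = a ∷ select n b x
select (suc n) (false ∷ b) (a ∷ x) = select (suc n) b x

spread : ∀ {m n} → Vec Bool m → Word n → Word m
spread []          _       = []
spread (true ∷ b)  []      = 𝟘
spread (true ∷ b)  (a ∷ x) = a ∷ spread b x
spread (false ∷ b) x       = 𝟎 ∷ spread b x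

-- The `bits` of a `Word 6` are the coefficients of the twelve generators; the two rows of a
-- coordinate serve its values `𝟏` and `ω`.
Decoder : ℕ → Set
Decoder = Vec (Vec (Word 6) 2)

-- When both deleted coordinates lie outside the information set, subtracting the punctured codeword
-- that agrees with `y` on that set leaves a word supported on the three marked coordinates. Its
-- entries there are the syndrome.
syndrome : (Word 11 → Word 9) → Decoder 9 → Vec (Word 3) 18
syndrome P Γ = matrix {9} (λ y → select 3 (zeroRows Γ) (y ⊕ P (lin {6} generators (lin {9} (concat Γ) y))))

representatives : Decoder 9 → Vec (Word 9) 6
representatives Γ = matrix {3} (spread (zeroRows Γ))

Decodes : Fin 11 → Fin 10 → Decoder 11 → Set
Decodes i k Γ = ParityCheck (delete i k)
  (syndrome (delete i k) (delete i k Γ)) (representatives (delete i k Γ)) (concat (delete i k Γ))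

decodes? : ∀ i k Γ → Dec (Decodes i k Γ)
decodes? i k Γ = parityCheck? (delete i k)
  (syndrome (delete i k) (delete i k Γ)) (representatives (delete i k Γ)) (concat (delete i k Γ))

coeff : F4 → F4 → F4 → F4 → F4 → F4 → Word 6
coeff a b c d e f = a ∷ b ∷ c ∷ d ∷ e ∷ f ∷ []

none : Vec (Word 6) 2
none = 𝟘 ∷ 𝟘 ∷ []

-- Each decoder belongs to an information set I of six coordinates of D⁻.  At a coordinate of I it
-- lists the generator coefficients of the codewords with value 𝟏, respectively ω, there and zero on the
-- rest of I.  Coordinates outside I carry zeros; once two of them are deleted, the remaining three
-- hold the syndrome.
decoders : List (Decoder 11)
decoders =
  ( none
    ∷ none
    ∷ none
    ∷ none
    ∷ (coeff ω² ω² 𝟎 ω ω² 𝟏 ∷ coeff 𝟏 ω ω ω 𝟎 ω ∷ [])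
    ∷ (coeff 𝟏 𝟏 ω² ω² 𝟎 𝟎 ∷ coeff ω² 𝟎 ω² ω 𝟏 𝟎 ∷ [])
    ∷ (coeff ω² ω² ω 𝟎 ω 𝟎 ∷ coeff 𝟎 𝟏 𝟏 𝟏 ω 𝟎 ∷ [])
    ∷ (coeff 𝟎 ω ω² ω² ω 𝟎 ∷ coeff 𝟏 𝟏 𝟏 𝟎 𝟏 𝟎 ∷ [])
    ∷ (coeff ω² ω² 𝟏 𝟏 𝟏 𝟎 ∷ coeff ω ω² 𝟎 ω² ω 𝟎 ∷ [])
    ∷ (coeff ω 𝟎 ω² ω² ω² 𝟎 ∷ coeff ω ω ω 𝟏 ω 𝟎 ∷ [])
    ∷ none
    ∷ [])
  ∷ ( none
    ∷ (coeff ω ω 𝟏 𝟎 𝟏 ω ∷ coeff 𝟎 𝟏 ω 𝟎 𝟏 𝟏 ∷ [])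
    ∷ (coeff ω² ω 𝟎 𝟏 ω² 𝟎 ∷ coeff ω 𝟎 𝟎 ω 𝟏 𝟏 ∷ [])
    ∷ none
    ∷ none
    ∷ none
    ∷ (coeff 𝟎 𝟏 𝟎 𝟎 ω² ω² ∷ coeff ω² 𝟏 𝟎 𝟎 ω 𝟎 ∷ [])
    ∷ none
    ∷ (coeff ω ω² 𝟎 𝟎 ω² ω ∷ coeff 𝟏 𝟏 𝟎 𝟎 ω ω² ∷ [])
    ∷ (coeff 𝟎 ω 𝟎 𝟎 ω² ω ∷ coeff 𝟏 𝟏 𝟎 𝟎 𝟎 𝟏 ∷ [])
    ∷ (coeff ω 𝟎 𝟎 𝟎 ω ω ∷ coeff ω² ω² 𝟎 𝟎 𝟎 ω ∷ [])
    ∷ [])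
  ∷ ( none
    ∷ (coeff ω² 𝟎 𝟏 𝟎 ω² 𝟎 ∷ coeff ω 𝟏 ω 𝟎 𝟎 𝟎 ∷ [])
    ∷ (coeff 𝟎 ω² 𝟎 𝟏 ω 𝟎 ∷ coeff 𝟏 ω 𝟎 ω ω² 𝟎 ∷ [])
    ∷ none
    ∷ (coeff 𝟎 𝟏 𝟎 𝟎 𝟏 𝟏 ∷ coeff ω² ω² 𝟎 𝟎 𝟏 ω ∷ [])
    ∷ (coeff ω ω² 𝟎 𝟎 𝟏 𝟎 ∷ coeff ω 𝟏 𝟎 𝟎 ω² 𝟎 ∷ [])
    ∷ none
    ∷ (coeff 𝟏 𝟎 𝟎 𝟎 ω 𝟎 ∷ coeff ω² ω² 𝟎 𝟎 𝟎 𝟎 ∷ [])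
    ∷ none
    ∷ none
    ∷ (coeff ω² ω 𝟎 𝟎 ω² 𝟎 ∷ coeff 𝟏 ω 𝟎 𝟎 ω 𝟎 ∷ [])
    ∷ [])
  ∷ ( (coeff ω² 𝟏 ω² ω 𝟎 ω² ∷ coeff ω ω 𝟏 ω 𝟎 𝟎 ∷ [])
    ∷ none
    ∷ none
    ∷ (coeff ω 𝟎 ω² 𝟏 𝟏 ω² ∷ coeff 𝟏 𝟎 ω² 𝟎 ω 𝟏 ∷ [])
    ∷ none
    ∷ (coeff 𝟎 𝟎 𝟏 ω 𝟎 𝟏 ∷ coeff ω 𝟎 ω² ω² 𝟎 𝟏 ∷ [])
    ∷ none
    ∷ (coeff 𝟎 𝟎 ω 𝟏 𝟎 ω² ∷ coeff ω² 𝟎 ω ω² 𝟎 ω ∷ [])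
    ∷ none
    ∷ (coeff 𝟎 𝟎 𝟏 𝟏 𝟎 ω ∷ coeff 𝟏 𝟎 𝟎 ω² 𝟎 𝟏 ∷ [])
    ∷ (coeff ω 𝟎 𝟏 ω² 𝟎 ω ∷ coeff ω² 𝟎 ω² 𝟎 𝟎 ω ∷ [])
    ∷ [])
  ∷ ( (coeff 𝟎 𝟏 𝟏 ω² 𝟎 ω² ∷ coeff 𝟏 ω ω ω 𝟎 ω ∷ [])
    ∷ none
    ∷ none
    ∷ (coeff 𝟏 𝟎 ω² 𝟎 𝟏 ω ∷ coeff ω² 𝟎 𝟎 ω² ω ω ∷ [])
    ∷ none
    ∷ (coeff 𝟏 𝟎 ω 𝟎 𝟎 ω² ∷ coeff ω 𝟎 𝟎 ω 𝟎 ω ∷ [])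
    ∷ (coeff 𝟏 𝟎 𝟏 ω 𝟎 ω² ∷ coeff ω² 𝟎 𝟎 𝟏 𝟎 𝟏 ∷ [])
    ∷ (coeff ω 𝟎 𝟏 ω 𝟎 𝟎 ∷ coeff 𝟎 𝟎 ω² ω² 𝟎 𝟏 ∷ [])
    ∷ (coeff ω² 𝟎 𝟏 𝟎 𝟎 ω² ∷ coeff 𝟎 𝟎 ω² 𝟏 𝟎 ω² ∷ [])
    ∷ none
    ∷ none
    ∷ [])
  ∷ ( (coeff ω 𝟏 ω ω 𝟎 𝟎 ∷ coeff 𝟎 ω ω² 𝟏 𝟎 𝟎 ∷ [])
    ∷ none
    ∷ none
    ∷ (coeff 𝟏 𝟎 ω 𝟎 𝟏 𝟎 ∷ coeff ω 𝟎 𝟏 𝟎 ω 𝟎 ∷ [])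
    ∷ (coeff ω² 𝟎 ω ω 𝟎 𝟏 ∷ coeff ω² 𝟎 𝟎 𝟏 𝟎 ω ∷ [])
    ∷ none
    ∷ (coeff 𝟏 𝟎 ω² 𝟏 𝟎 𝟎 ∷ coeff ω² 𝟎 ω² ω 𝟎 𝟎 ∷ [])
    ∷ none
    ∷ (coeff 𝟎 𝟎 ω ω 𝟎 𝟎 ∷ coeff 𝟏 𝟎 𝟏 𝟏 𝟎 𝟎 ∷ [])
    ∷ none
    ∷ (coeff ω² 𝟎 𝟏 𝟏 𝟎 𝟎 ∷ coeff ω 𝟎 𝟏 ω 𝟎 𝟎 ∷ [])
    ∷ [])
  ∷ ( (coeff ω² 𝟏 𝟎 𝟎 𝟎 𝟎 ∷ coeff ω ω 𝟎 𝟎 𝟎 𝟎 ∷ [])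
    ∷ (coeff ω² 𝟎 𝟏 𝟎 𝟎 𝟎 ∷ coeff ω 𝟎 ω 𝟎 𝟎 𝟎 ∷ [])
    ∷ (coeff 𝟎 𝟎 𝟎 𝟏 𝟎 𝟎 ∷ coeff ω² 𝟎 𝟎 ω 𝟎 𝟎 ∷ [])
    ∷ (coeff 𝟏 𝟎 𝟎 𝟎 𝟏 𝟎 ∷ coeff 𝟎 𝟎 𝟎 𝟎 ω 𝟎 ∷ [])
    ∷ (coeff 𝟎 𝟎 𝟎 𝟎 𝟎 𝟏 ∷ coeff ω 𝟎 𝟎 𝟎 𝟎 ω ∷ [])
    ∷ none
    ∷ none
    ∷ none
    ∷ none
    ∷ (coeff 𝟏 𝟎 𝟎 𝟎 𝟎 𝟎 ∷ coeff ω 𝟎 𝟎 𝟎 𝟎 𝟎 ∷ [])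
    ∷ none
    ∷ [])
  ∷ []

-- Each pair of coordinates lies in the complement of one of the seven information sets. Evaluation
-- over the 110 choices of `i` and `k` finds a decoder and verifies its parity check, including the
-- charges.
decoders-cover : ∀ i k → Any (Decodes i k) decoders
decoders-cover = toWitness {a? = Finₚ.all? λ i → Finₚ.all? λ k → Any.any? (decodes? i k) decoders} _

-- The coset graph as a Cayley graph on syndromes.

module _ (i : Fin 11) (j : Fin 11) (i≢j : i ≢ j) {σ ρ γ} (check : ParityCheck (puncture i j i≢j) σ ρ γ) where

  open ParityCheck check
  open CosetGraph (D³⁻ i j i≢j)

  private
    C   = D³⁻ i j i≢j
    syn = lin {9} σ
    rep = lin {3} ρ

  puncture-additive : Additive (puncture i j i≢j)
  puncture-additive = ∘-additive (removeAt-additive (punchOut i≢j)) (removeAt-additive i)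

  syn-additive : Additive syn
  syn-additive = lin-additive {9} σ

  syn-rep : ∀ u → syn (rep u) ≡ u
  syn-rep = additive-ext (∘-additive {f = syn} syn-additive (lin-additive {3} ρ)) (λ _ _ → refl) section

  C⇒syn≡𝟘 : ∀ {y} → C y → syn y ≡ 𝟘
  C⇒syn≡𝟘 (_ , (c , refl) , refl) =
    combination-kernel (∘-additive {f = syn} syn-additive puncture-additive) vanishes c

  -- At zero syndrome the representative is `𝟘`, so the identity checked in `residue` exhibits `y`
  -- itself as a punctured codeword.
  syn≡𝟘⇒C : ∀ {y} → syn y ≡ 𝟘 → C y
  syn≡𝟘⇒C {y} eq = lin {6} generators (lin {9} γ y) , (bits (lin {9} γ y) , refl) , (begin
    puncture i j i≢j (lin {6} generators (lin {9} γ y))   ≡⟨ residue-all y ⟨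
    y ⊕ rep (syn y)                                       ≡⟨ cong (λ u → y ⊕ rep u) eq ⟩
    y ⊕ rep 𝟘                                             ≡⟨ cong (y ⊕_) (additive-𝟘 (lin-additive {3} ρ)) ⟩
    y ⊕ 𝟘                                                 ≡⟨ ⊕-identityʳ y ⟩
    y                                                     ∎)
    where
    residue-all : ∀ y → y ⊕ rep (syn y) ≡ puncture i j i≢j (lin {6} generators (lin {9} γ y))
    residue-all = additive-ext
      (⊕-additive {f = λ y → y} (λ _ _ → refl) (∘-additive {f = rep} (lin-additive {3} ρ) syn-additive))
      (∘-additive {f = puncture i j i≢j} puncture-additive
        (∘-additive {f = lin {6} generators} (lin-additive {6} generators) (lin-additive {9} γ)))
      residue

  R : Fin 64 → Word 9
  R a = rep (word a)

  syn-⊖ : ∀ a b → syn (R a ⊖ R b) ≡ word a ⊕ word b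
  -- `⊖` unfolds to `⊕`, as `⊝` is the identity.
  syn-⊖ a b = trans (syn-additive (R a) (R b)) (cong₂ _⊕_ (syn-rep (word a)) (syn-rep (word b)))

  R-transversal : IsTransversal R
  R-transversal =
      (λ a b same → word-injective {3} (⊕≡𝟘⇒≡ (trans (sym (syn-⊖ a b)) (C⇒syn≡𝟘 same))))
    , (λ x → index (syn x) , syn≡𝟘⇒C (begin
        syn (x ⊖ R (index (syn x)))             ≡⟨ syn-additive x (R (index (syn x))) ⟩
        syn x ⊕ syn (R (index (syn x)))         ≡⟨ cong (syn x ⊕_) (syn-rep (word (index (syn x)))) ⟩
        syn x ⊕ word (index (syn x))            ≡⟨ cong (syn x ⊕_) (word-index (syn x)) ⟩
        syn x ⊕ syn x                           ≡⟨ ⊕-self (syn x) ⟩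
        𝟘                                       ∎))

  -- A word lies in the code exactly when its syndrome vanishes, so a weight-one word witnesses
  -- adjacency exactly when its syndrome is the difference of the two vertex syndromes.
  adjacent⇔ : ∀ a b → Adjacent (R a) (R b) ⇔ ((word a ⊕ word b) ∈ map syn (weightOne 9))
  adjacent⇔ a b = mk⇔ to from
    where
    syn-difference : ∀ w → syn ((R a ⊖ R b) ⊖ w) ≡ (word a ⊕ word b) ⊕ syn w
    syn-difference w = trans (syn-additive (R a ⊖ R b) w) (cong (_⊕ syn w) (syn-⊖ a b))

    to : Adjacent (R a) (R b) → (word a ⊕ word b) ∈ map syn (weightOne 9)
    to (w , weight≡1 , c) = subst (_∈ map syn (weightOne 9))
      (sym (⊕≡𝟘⇒≡ (trans (sym (syn-difference w)) (C⇒syn≡𝟘 c))))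
      (∈-map⁺ syn (weightOne-complete w weight≡1))

    from : (word a ⊕ word b) ∈ map syn (weightOne 9) → Adjacent (R a) (R b)
    from ab∈ = let w , w∈ , ab≡ = ∈-map⁻ syn ab∈ in
      w , All.lookup (weightOne-sound 9) w∈ ,
      syn≡𝟘⇒C (trans (syn-difference w) (trans (cong (_⊕ syn w) ab≡) (⊕-self (syn w))))

  parityCheck-theorem : Σ (Fin 64 → Word 9) λ R →
      IsTransversal R
    × IsSRG 64 27 10 12 (λ a b → Adjacent (R a) (R b)) (λ a b → Adjacent? i j i≢j (R a) (R b))
    × HasSpectrum (adjMatrix (λ a b → Adjacent? i j i≢j (R a) (R b)))
        ((ℤ→ℚ (+ 27) , 1) ∷ (ℤ→ℚ (+ 3) , 36) ∷ (ℤ→ℚ (- (+ 5)) , 27) ∷ [])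
  parityCheck-theorem = R , R-transversal
    , twoWeight-srg twoWeight (λ a b → Adjacent? i j i≢j (R a) (R b)) adjacent⇔
    , twoWeight-spectrum twoWeight (λ a b → Adjacent? i j i≢j (R a) (R b)) adjacent⇔

theorem12 : (i j : Fin 11) (i≢j : i ≢ j) →
    Σ (Fin 64 → Word 9) λ R →
    CosetGraph.IsTransversal (D³⁻ i j i≢j) R
    × IsSRG 64 27 10 12
    (λ a b → CosetGraph.Adjacent (D³⁻ i j i≢j) (R a) (R b))
    (λ a b → Adjacent? i j i≢j (R a) (R b))
    × HasSpectrum (adjMatrix (λ a b → Adjacent? i j i≢j (R a) (R b)))
    ((ℤ→ℚ (+ 27) , 1) ∷ (ℤ→ℚ (+ 3) , 36) ∷ (ℤ→ℚ (- (+ 5)) , 27) ∷ [])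
theorem12 i j i≢j = parityCheck-theorem i j i≢j (proj₂ (Any.satisfied (decoders-cover i (punchOut i≢j))))
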